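{- Let $k \geq \ell \geq 2$ and $n > k + \ell$ be integers. Suppose that $\mathcal F \subset \binom{[n]}{k}$ and $\mathcal G \subset \binom{[n]}{\ell}$ are non-trivial and cross-intersecting. Then $$|\mathcal F| + |\mathcal G| \leq \binom{n}{k} - 2\binom{n-\ell}{k} + \binom{n-2\ell}{k} + 2.$$ Moreover, unless $k = \ell = 2$, equality holds only if, up to symmetry (a permutation of $[n]$, and when $k=\ell$ also interchanging $\mathcal F$ and $\mathcal G$), $\mathcal G = \{U, V\}$ for two disjoint $\ell$-subsets $U, V$ of $[n]$ and $\mathcal F = \{F \in \binom{[n]}{k} : F \cap U \neq \emptyset,\ F \cap V \neq \emptyset\}$.
   Context: $[n] = \{1,\dots,n\}$ and $\binom{[n]}{k}$ is the collection of $k$-element subsets of $[n]$. Families $\mathcal F, \mathcal G$ are cross-intersecting if $F \cap G \neq \emptyset$ for all $F \in \mathcal F$, $G \in \mathcal G$. A family $\mathcal F$ is non-trivial if $\bigcap_{F \in \mathcal F} F = \emptyset$. -}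

module Defs where

open import Data.Nat using (ℕ)
open import Data.Fin.Subset using (Subset; _∩_; ∣_∣; Nonempty; Empty; _∉_)
open import Data.List using (List)
open import Data.List.Relation.Unary.All using (All)
open import Data.List.Relation.Unary.Unique.Propositional using (Unique)
open import Data.List.Membership.Propositional using () renaming (_∈_ to _∈L_)
open import Data.Product using (Σ; ∃; _×_)
open import Data.Sum using (_⊎_)
open import Function.Bundles using (_⇔_)
open import Relation.Binary.PropositionalEquality using (_≡_)

-- A family of subsets of [n] = Fin n, given as a duplicate-free list.
Family : ℕ → Set
Family n = List (Subset n)

_∈F_ : ∀ {n} → Subset n → Family n → Set
A ∈F 𝓕 = A ∈L 𝓕

-- 𝓕 ⊆ binom([n], k): no repetitions and every member has exactly k elements
-- (|𝓕| is then the list length)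
IsKFamily : ∀ {n} → ℕ → Family n → Set
IsKFamily k 𝓕 = Unique 𝓕 × All (λ A → ∣ A ∣ ≡ k) 𝓕

NonTrivial : ∀ {n} → Family n → Set
NonTrivial {n} 𝓕 = ∀ x → ∃ λ A → A ∈F 𝓕 × x ∉ A

CrossIntersecting : ∀ {n} → Family n → Family n → Set
CrossIntersecting 𝓕 𝓖 = ∀ {A B} → A ∈F 𝓕 → B ∈F 𝓖 → Nonempty (A ∩ B)

Extremal : ∀ {n} → (k ℓ : ℕ) → Family n → Family n → Set
Extremal {n} k ℓ 𝓕 𝓖 =
  Σ (Subset n) λ U → Σ (Subset n) λ V →
    ∣ U ∣ ≡ ℓ × ∣ V ∣ ≡ ℓ × Empty (U ∩ V)
    × (∀ A → (A ∈F 𝓖) ⇔ (A ≡ U ⊎ A ≡ V))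
    × (∀ A → (A ∈F 𝓕) ⇔ (∣ A ∣ ≡ k × Nonempty (A ∩ U) × Nonempty (A ∩ V)))

{-# OPTIONS --safe #-}
-- Throughout, a family on [n] is handled through the families F(x) = {A ∖ x : x ∈ A ∈ F} and
-- F(x̄) = {A ∈ F : x ∉ A} on [n] ∖ x; for cross-intersecting F and G the pairs (F(x), G(x̄)) and (F(x̄), G(x))
-- are again cross-intersecting. Take U ∈ G and split successively at its elements u₁, …, u_ℓ: apart from U itself,
-- the sets of F with first element uᵢ get paired with the sets of G with first missing element uᵢ. Every pair is
-- bounded by the classical estimate |F| + |G| ≤ C(n,k) − C(n−ℓ,k) + 1 for nonempty families, or, when its G-part
-- is empty, by the number of sets meeting a member of G that misses uᵢ; summing up gives the bound.
-- Only the pair at u₁ is critical, and only if k = ℓ. It is harmless if u₁ = x for a two-element transversal {x, y}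
-- of G such that some member of F contains x but not y, or likewise with F and G exchanged. Otherwise, for a pair
-- to which no set can be added, some w lies in no two-element transversal; shifting w to all other elements then
-- keeps both families nontrivial on [n] ∖ w and makes F(w) and G(w) cross-intersecting, so induction on n applies.
-- The inequality is strict unless G (or F, if k = ℓ) has at most two members, hence is {U, V} with U and V disjoint.
module Submission where

open import Defs
open import Data.Nat using (ℕ; zero; suc; _+_; _*_; _∸_; _≤_; _<_; z≤n; s≤s)
open import Data.Nat.Properties
open import Data.Nat.Combinatorics using (_C_; nCk≡nC[n∸k]; nCk+nC[k+1]≡[n+1]C[k+1])
open import Data.Nat.Induction using (<-wellFounded)
open import Data.Nat.Tactic.RingSolver using (solve-∀)
open import Data.Bool using (Bool; true; false; _∧_; _∨_; not; if_then_else_) renaming (_≟_ to _≟ᵇ_)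
open import Data.Bool.Properties using (∨-zeroʳ; ∨-comm; ∨-assoc; ∧-identityʳ)
open import Data.Fin using (Fin; zero; suc; punchIn; punchOut; fromℕ<)
open import Data.Fin.Properties using (punchInᵢ≢i; punchIn-punchOut; any?) renaming (_≟_ to _≟ᶠ_)
open import Data.Fin.Subset using (Subset; ∣_∣; ⊥; _∩_; Nonempty; Empty)
open import Data.Fin.Subset.Properties using (∣⊥∣≡0; ∣p∣≤n; anySubset?; x∈p∩q⁻; ∩-comm)
open import Data.Vec using ([]; _∷_; lookup; insertAt; removeAt; _[_]≔_)
open import Data.Vec.Properties using (≡-dec; ∷-injectiveʳ; lookup-replicate; lookup∘update; lookup∘update′; []=⇒lookup;
  lookup⇒[]=; insertAt-lookup; insertAt-punchIn; insertAt-removeAt; removeAt-insertAt)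
open import Data.List using (List; []; _∷_; length)
open import Data.List.Membership.Propositional using () renaming (_∈_ to _∈L_)
import Data.List.Membership.DecPropositional as DecMembership
open import Data.List.Relation.Unary.All as All using (All; []; _∷_)
open import Data.List.Relation.Unary.All.Properties using (¬Any⇒All¬)
open import Data.List.Relation.Unary.AllPairs using ([]; _∷_)
open import Data.List.Relation.Unary.Any using (here; there)
open import Data.List.Relation.Unary.Unique.Propositional using (Unique)
open import Data.Product using (∃; ∃₂; _×_; _,_; proj₁; proj₂)
open import Data.Sum as Sum using (_⊎_; inj₁; inj₂)
open import Data.Empty using () renaming (⊥ to Absurd)
open import Function using (_∘_)
open import Function.Bundles using (mk⇔)
open import Induction.WellFounded using (Acc; acc)
open import Relation.Nullary using (¬_; yes; no; Dec; contradiction)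
open import Relation.Nullary.Decidable using (⌊_⌋; _×-dec_; ¬?)
open import Relation.Binary.PropositionalEquality

-- Counting functions: binomial coefficients, `h` and `m`

medial : ∀ a b c d → (a + b) + (c + d) ≡ (a + c) + (b + d)
medial = solve-∀

-- Pascal's rule holds by computation here, to match the splitting of a family at an element;
-- `bin≡C` returns to `_C_`.
bin : ℕ → ℕ → ℕ
bin n       zero    = 1
bin zero    (suc r) = 0
bin (suc n) (suc r) = bin n r + bin n (suc r)

-- h n p r counts the r-subsets of an n-set that meet a fixed p-subset, by the first element they share.
h : ℕ → ℕ → ℕ → ℕ
h n       zero    r       = 0
h zero    (suc p) r       = 0
h (suc n) (suc p) zero    = 0
h (suc n) (suc p) (suc r) = bin n r + h n p (suc r)

-- m n j p r counts the r-subsets of an n-set that meet each of two disjoint subsets of sizes j and p.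
m : ℕ → ℕ → ℕ → ℕ → ℕ
m n       zero    p r       = 0
m zero    (suc j) p r       = 0
m (suc n) (suc j) p zero    = 0
m (suc n) (suc j) p (suc r) = h n p r + m n j p (suc r)

bin≡C : ∀ n r → bin n r ≡ n C r
bin≡C n       zero    = refl
bin≡C zero    (suc r) = refl
bin≡C (suc n) (suc r) =
  trans (cong₂ _+_ (bin≡C n r) (bin≡C n (suc r))) (nCk+nC[k+1]≡[n+1]C[k+1] n r)

bin-sym : ∀ r s → bin (r + s) r ≡ bin (r + s) s
bin-sym r s = begin
  bin (r + s) r         ≡⟨ bin≡C (r + s) r ⟩
  (r + s) C r           ≡⟨ nCk≡nC[n∸k] (m≤m+n r s) ⟩
  (r + s) C (r + s ∸ r) ≡⟨ cong ((r + s) C_) (m+n∸m≡n r s) ⟩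
  (r + s) C s           ≡⟨ sym (bin≡C (r + s) s) ⟩
  bin (r + s) s ∎
  where open ≡-Reasoning

bin-pos : ∀ {n r} → r ≤ n → 1 ≤ bin n r
bin-pos {n}     {zero}  _         = ≤-refl
bin-pos {suc n} {suc r} (s≤s r≤n) = ≤-trans (bin-pos r≤n) (m≤m+n _ _)

bin-full : ∀ n → bin n n ≡ 1
bin-full n = trans (bin≡C n n) (trans (nCk≡nC[n∸k] {n} ≤-refl) (cong (n C_) (n∸n≡0 n)))

bin≥2 : ∀ {n t} → suc (suc t) ≤ n → 2 ≤ bin n (suc t)
bin≥2 {suc n} (s≤s t<n) = +-mono-≤ (bin-pos (<⇒≤ t<n)) (bin-pos t<n)

h-zero : ∀ n p → h n p 0 ≡ 0
h-zero n       zero    = refl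
h-zero zero    (suc p) = refl
h-zero (suc n) (suc p) = refl

m-zero : ∀ n j p → m n j p 0 ≡ 0
m-zero n       zero    p = refl
m-zero zero    (suc j) p = refl
m-zero (suc n) (suc j) p = refl

-- The second summand counts the sets that miss the p-subset.
h+bin : ∀ {n p} r → p ≤ n → h n p r + bin (n ∸ p) r ≡ bin n r
h+bin r       z≤n       = refl
h+bin zero    (s≤s p≤n) = refl
h+bin {suc n} {suc p} (suc r) (s≤s p≤n) =
  trans (+-assoc (bin n r) _ _) (cong (bin n r +_) (h+bin (suc r) p≤n))

h≤bin : ∀ {n p} r → p ≤ n → h n p r ≤ bin n r
h≤bin r p≤n = ≤-trans (m≤m+n _ _) (≤-reflexive (h+bin r p≤n))

-- Inclusion-exclusion: sets missing one block are subtracted, sets missing both are restored. This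
-- ties `m` to the closed formula of the theorem.
m+bin : ∀ {n j p} r → j + p ≤ n →
  m n j p r + (bin (n ∸ p) r + bin (n ∸ j) r) ≡ bin n r + bin (n ∸ j ∸ p) r
m+bin {n} {zero} {p} r _ = +-comm (bin (n ∸ p) r) (bin n r)
m+bin {suc n} {suc j} zero (s≤s _) = refl
m+bin {suc n} {suc j} {p} (suc r) (s≤s j+p≤n)
  rewrite +-∸-assoc 1 {n} {p} (≤-trans (m≤n+m p j) j+p≤n) = begin
  (h n p r + m n j p (suc r)) + ((bin (n ∸ p) r + bin (n ∸ p) (suc r)) + bin (n ∸ j) (suc r))
    ≡⟨ shuffle (h n p r) _ _ _ _ ⟩
  (h n p r + bin (n ∸ p) r) + (m n j p (suc r) + (bin (n ∸ p) (suc r) + bin (n ∸ j) (suc r)))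
    ≡⟨ cong₂ _+_ (h+bin r (≤-trans (m≤n+m p j) j+p≤n)) (m+bin {n} {j} {p} (suc r) j+p≤n) ⟩
  bin n r + (bin n (suc r) + bin (n ∸ j ∸ p) (suc r))
    ≡⟨ sym (+-assoc (bin n r) _ _) ⟩
  (bin n r + bin n (suc r)) + bin (n ∸ j ∸ p) (suc r) ∎
  where
  open ≡-Reasoning
  shuffle : ∀ a b c d e → (a + b) + ((c + d) + e) ≡ (a + c) + (b + (d + e))
  shuffle = solve-∀

-- Distinguishes whether a set contains a fixed element outside the p-subset.
h-pascal : ∀ {n p} r → p ≤ n → h (suc n) p (suc r) ≡ h n p (suc r) + h n p r
h-pascal r z≤n = refl
h-pascal {suc n} {suc p} zero (s≤s p≤n)
  rewrite h-pascal 0 p≤n | h-zero n p = refl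
h-pascal {suc n} {suc p} (suc r) (s≤s p≤n)
  rewrite h-pascal (suc r) p≤n = shuffle (bin n r) _ _ _
  where
  shuffle : ∀ a b c d → (a + b) + (c + d) ≡ (b + c) + (a + d)
  shuffle = solve-∀

-- Distinguishes whether a set contains a fixed element outside both blocks; splitting both families
-- at `w` is measured against this recurrence.
m-pascal : ∀ {n} j {p} r → j + p ≤ n → m (suc n) j p (suc r) ≡ m n j p (suc r) + m n j p r
m-pascal zero r _ = refl
m-pascal {suc n} (suc j) {p} zero (s≤s j+p≤n)
  rewrite m-pascal j {p} 0 j+p≤n | h-zero n p | h-zero (suc n) p | m-zero n j p = refl
m-pascal {suc n} (suc j) {p} (suc r) (s≤s j+p≤n)
  rewrite h-pascal {n} {p} r (≤-trans (m≤n+m p j) j+p≤n) | m-pascal j {p} (suc r) j+p≤n =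
  medial (h n p (suc r)) _ _ _

-- The sets gained by enlarging the p-subset contain the new element and miss the `p` old ones.
h-suc : ∀ {n p} r → suc p ≤ n → h n p (suc r) + bin (n ∸ suc p) r ≡ h n (suc p) (suc r)
h-suc {suc n} {zero} r _ = sym (+-identityʳ _)
h-suc {suc n} {suc p} r (s≤s p<n) =
  trans (+-assoc (bin n r) _ _) (cong (bin n r +_) (h-suc r p<n))

h-mono : ∀ n {p p′} r → p ≤ p′ → h n p r ≤ h n p′ r
h-mono n       r       z≤n        = z≤n
h-mono zero    r       (s≤s p≤p′) = z≤n
h-mono (suc n) zero    (s≤s p≤p′) = z≤n
h-mono (suc n) (suc r) (s≤s p≤p′) = +-monoʳ-≤ (bin n r) (h-mono n (suc r) p≤p′)

m-mono : ∀ n j {p p′} r → p ≤ p′ → m n j p r ≤ m n j p′ r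
m-mono n       zero    r       p≤p′ = z≤n
m-mono zero    (suc j) r       p≤p′ = z≤n
m-mono (suc n) (suc j) zero    p≤p′ = z≤n
m-mono (suc n) (suc j) (suc r) p≤p′ = +-mono-≤ (h-mono n r p≤p′) (m-mono n j (suc r) p≤p′)

-- The size hypothesis leaves room for one of the sets gained in `h-suc`.
h-gap₁ : ∀ {n p q} r → p < q → p + suc r ≤ n → h n p (suc r) + 1 ≤ h n q (suc r)
h-gap₁ {n} {p} {q} r p<q le = begin
  h n p (suc r) + 1                     ≤⟨ +-monoʳ-≤ _ (bin-pos (m+n≤o⇒m≤o∸n r r+sp≤n)) ⟩
  h n p (suc r) + bin (n ∸ suc p) r     ≡⟨ h-suc r (≤-trans (m≤n+m (suc p) r) r+sp≤n) ⟩
  h n (suc p) (suc r)                   ≤⟨ h-mono n (suc r) p<q ⟩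
  h n q (suc r) ∎
  where
  open ≤-Reasoning
  r+sp≤n : r + suc p ≤ n
  r+sp≤n = ≤-trans (≤-reflexive (trans (+-suc r p) (trans (cong suc (+-comm r p)) (sym (+-suc p r))))) le

-- With one more free element than is needed for a single set, `h-suc` gains at least two.
h-gap₂ : ∀ {n p q} r → p < q → p + suc (suc (suc r)) ≤ n → h n p (suc (suc r)) + 2 ≤ h n q (suc (suc r))
h-gap₂ {n} {p} {q} r p<q le = begin
  h n p (suc (suc r)) + 2                       ≤⟨ +-monoʳ-≤ _ (bin≥2 (m+n≤o⇒m≤o∸n (suc (suc r)) r+sp≤n)) ⟩
  h n p (suc (suc r)) + bin (n ∸ suc p) (suc r) ≡⟨ h-suc (suc r) (≤-trans (m≤n+m (suc p) (suc (suc r))) r+sp≤n) ⟩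
  h n (suc p) (suc (suc r))                     ≤⟨ h-mono n (suc (suc r)) p<q ⟩
  h n q (suc (suc r)) ∎
  where
  open ≤-Reasoning
  shuffle : ∀ r p → suc (suc r) + suc p ≡ p + suc (suc (suc r))
  shuffle = solve-∀
  r+sp≤n : suc (suc r) + suc p ≤ n
  r+sp≤n = ≤-trans (≤-reflexive (shuffle r p)) le

-- Each of three elements of the p-subset occurs as the first common element of some set.
h≥3 : ∀ {n p} t → 3 ≤ p → t + 3 ≤ n → 3 ≤ h n p (suc t)
h≥3 {n} {p} t 3≤p le rewrite +-comm t 3 with le
... | s≤s (s≤s (s≤s {n = n′} t≤n)) =
  ≤-trans (+-mono-≤ (bin-pos (m≤n⇒m≤1+n (m≤n⇒m≤1+n t≤n)))
            (+-mono-≤ (bin-pos (m≤n⇒m≤1+n t≤n)) (+-mono-≤ (bin-pos t≤n) z≤n)))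
          (h-mono (suc (suc (suc n′))) (suc t) 3≤p)

-- The sets gained by enlarging the first block miss its `j` old elements, contain the new one and
-- meet the other block among the elements that remain.
m-suc : ∀ {n j} p r → suc j ≤ n → m n (suc j) p (suc r) ≡ m n j p (suc r) + h (n ∸ suc j) p r
m-suc {suc n} {zero} p r _ = +-identityʳ _
m-suc {suc n} {suc j} p r (s≤s j<n) =
  trans (cong (h n p r +_) (m-suc p r j<n)) (sym (+-assoc (h n p r) _ _))

-- Families and their links

-- Boolean predicates make links plain compositions and allow members to be searched for.
Fam : ℕ → Set
Fam n = Subset n → Bool

infix 4 _∋_ _⊆ᶠ_
_∋_ : ∀ {n} → Fam n → Subset n → Set
F ∋ A = F A ≡ true

_⊆ᶠ_ : ∀ {n} → Fam n → Fam n → Set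
F ⊆ᶠ G = ∀ A → F ∋ A → G ∋ A

NE : ∀ {n} → Fam n → Set
NE F = ∃ λ A → F ∋ A

Unif : ∀ {n} → ℕ → Fam n → Set
Unif k F = ∀ A → F ∋ A → ∣ A ∣ ≡ k

true≢false : ∀ {a} {X : Set a} {b : Bool} → b ≡ true → b ≡ false → X
true≢false refl ()

∧-true : ∀ {a b} → a ≡ true → b ≡ true → a ∧ b ≡ true
∧-true refl refl = refl

∧-split : ∀ a {b} → a ∧ b ≡ true → a ≡ true × b ≡ true
∧-split true e = refl , e

∨-true : ∀ a {b} → a ∨ b ≡ true → a ≡ true ⊎ b ≡ true
∨-true true  e = inj₁ refl
∨-true false e = inj₂ e

∨-trueʳ : ∀ a {b} → b ≡ true → a ∨ b ≡ true
∨-trueʳ a refl = ∨-zeroʳ a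

¬true→false : ∀ {b} → ¬ (b ≡ true) → b ≡ false
¬true→false {true}  ne = contradiction refl ne
¬true→false {false} ne = refl

¬false→true : ∀ {b} → ¬ (b ≡ false) → b ≡ true
¬false→true {true}  ne = refl
¬false→true {false} ne = contradiction refl ne

-- Subsets: splitting at an element, common elements, sets of prescribed size

ins : ∀ {n} → Fin (suc n) → Bool → Subset n → Subset (suc n)
ins x b A = insertAt A x b

-- Case distinction on whether an arbitrary `x` lies in a set, with the rest of the set moved to the
-- ground set without `x`.
data View {n} (x : Fin (suc n)) : Subset (suc n) → Set where
  at : ∀ b A → View x (ins x b A)

view : ∀ {n} x (A : Subset (suc n)) → View x A
view x A = subst (View x) (insertAt-removeAt A x) (at (lookup A x) (removeAt A x))

∣ins-true∣ : ∀ {n} x (A : Subset n) → ∣ ins x true A ∣ ≡ suc ∣ A ∣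
∣ins-true∣ zero    A           = refl
∣ins-true∣ (suc x) (true ∷ A)  = cong suc (∣ins-true∣ x A)
∣ins-true∣ (suc x) (false ∷ A) = ∣ins-true∣ x A

∣ins-true∣⁻¹ : ∀ {n s} x (A : Subset n) → ∣ ins x true A ∣ ≡ suc s → ∣ A ∣ ≡ s
∣ins-true∣⁻¹ x A e = suc-injective (trans (sym (∣ins-true∣ x A)) e)

∣ins-false∣ : ∀ {n} x (A : Subset n) → ∣ ins x false A ∣ ≡ ∣ A ∣
∣ins-false∣ zero    A           = refl
∣ins-false∣ (suc x) (true ∷ A)  = cong suc (∣ins-false∣ x A)
∣ins-false∣ (suc x) (false ∷ A) = ∣ins-false∣ x A

∣≤ins∣ : ∀ {n} x b (A : Subset n) → ∣ A ∣ ≤ ∣ ins x b A ∣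
∣≤ins∣ x true  A = ≤-trans (n≤1+n _) (≤-reflexive (sym (∣ins-true∣ x A)))
∣≤ins∣ x false A = ≤-reflexive (sym (∣ins-false∣ x A))

meets : ∀ {n} → Subset n → Subset n → Bool
meets []      []      = false
meets (a ∷ A) (b ∷ B) = (a ∧ b) ∨ meets A B

meets-ins : ∀ {n} x a b (A B : Subset n) → meets (ins x a A) (ins x b B) ≡ (a ∧ b) ∨ meets A B
meets-ins zero    a b A        B        = refl
meets-ins (suc x) a b (a′ ∷ A) (b′ ∷ B)
  rewrite meets-ins x a b A B
        | sym (∨-assoc (a′ ∧ b′) (a ∧ b) (meets A B))
        | sym (∨-assoc (a ∧ b) (a′ ∧ b′) (meets A B))
        | ∨-comm (a′ ∧ b′) (a ∧ b) = refl

meets-sym : ∀ {n} (A B : Subset n) → meets A B ≡ meets B A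
meets-sym []          []          = refl
meets-sym (true ∷ A)  (true ∷ B)  = refl
meets-sym (true ∷ A)  (false ∷ B) = meets-sym A B
meets-sym (false ∷ A) (true ∷ B)  = meets-sym A B
meets-sym (false ∷ A) (false ∷ B) = meets-sym A B

point : ∀ {n} (A B : Subset n) → meets A B ≡ true → ∃ λ x → lookup A x ≡ true × lookup B x ≡ true
point []          []          ()
point (true ∷ A)  (true ∷ B)  e = zero , refl , refl
point (true ∷ A)  (false ∷ B) e with point A B e
... | x , p , q = suc x , p , q
point (false ∷ A) (b ∷ B)     e with point A B e
... | x , p , q = suc x , p , q

meets-at : ∀ {n} (A B : Subset n) x → lookup A x ≡ true → lookup B x ≡ true → meets A B ≡ true
meets-at (true ∷ A) (true ∷ B) zero    p q = refl
meets-at (a ∷ A)    (b ∷ B)    (suc x) p q = ∨-trueʳ (a ∧ b) (meets-at A B x p q)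

element : ∀ {n s} (A : Subset n) → ∣ A ∣ ≡ suc s → ∃ λ x → lookup A x ≡ true
element (true ∷ A)  e = zero , refl
element (false ∷ A) e with element A e
... | x , p = suc x , p

∣A∣≡0→∉ : ∀ {n} (A : Subset n) → ∣ A ∣ ≡ 0 → ∀ x → lookup A x ≡ false
∣A∣≡0→∉ (false ∷ A) e zero    = refl
∣A∣≡0→∉ (false ∷ A) e (suc x) = ∣A∣≡0→∉ A e x

meets-∅ : ∀ {n} (A B : Subset n) → ∣ B ∣ ≡ 0 → meets A B ≡ false
meets-∅ A B e = ¬true→false λ t → let x , _ , q = point A B t in true≢false q (∣A∣≡0→∉ B e x)

outside-both : ∀ {n} (A B : Subset n) → ∣ A ∣ + ∣ B ∣ < n → ∃ λ x → lookup A x ≡ false × lookup B x ≡ false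
outside-both (false ∷ A) (false ∷ B) _  = zero , refl , refl
outside-both (true ∷ A)  (b ∷ B) (s≤s l) with outside-both A B (≤-trans (s≤s (+-monoʳ-≤ ∣ A ∣ (∣≤ins∣ zero b B))) l)
... | x , p , q = suc x , p , q
outside-both (false ∷ A) (true ∷ B) (s≤s l)
  with outside-both A B (≤-trans (≤-reflexive (sym (+-suc ∣ A ∣ ∣ B ∣))) l)
... | x , p , q = suc x , p , q

difference : ∀ {n} (A B : Subset n) → ∣ B ∣ ≤ ∣ A ∣ → A ≢ B → ∃ λ x → lookup A x ≡ true × lookup B x ≡ false
difference [] [] _ ne = contradiction refl ne
difference (true ∷ A) (false ∷ B) _ ne = zero , refl , refl
difference (true ∷ A) (true ∷ B) (s≤s l) ne with difference A B l (ne ∘ cong (true ∷_))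
... | x , p , q = suc x , p , q
difference (false ∷ A) (false ∷ B) l ne with difference A B l (ne ∘ cong (false ∷_))
... | x , p , q = suc x , p , q
difference (false ∷ A) (true ∷ B) l ne
  with difference A B (≤-trans (n≤1+n _) l) (λ e → <-irrefl (cong ∣_∣ (sym e)) l)
... | x , p , q = suc x , p , q

between : ∀ {n} k (S D : Subset n) → meets S D ≡ false → ∣ S ∣ ≤ k → ∣ D ∣ + k ≤ n →
  ∃ λ B → ∣ B ∣ ≡ k × (∀ {i} → lookup S i ≡ true → lookup B i ≡ true) × meets B D ≡ false
between k S D S∩D s≤k l with m≤n⇒m<n∨m≡n s≤k
... | inj₂ refl = S , refl , (λ p → p) , S∩D
between (suc k) [] D S∩D s≤k l | inj₁ s<k = contradiction (≤-trans (m≤n+m (suc k) ∣ D ∣) l) λ ()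
between (suc k) (true ∷ S) (false ∷ D) S∩D s≤k l | inj₁ (s≤s s<k)
  with between k S D S∩D (<⇒≤ s<k) (≤-pred (≤-trans (≤-reflexive (sym (+-suc ∣ D ∣ k))) l))
... | B , e , sub , dis = true ∷ B , cong suc e , (λ { {zero} p → refl ; {suc i} p → sub {i} p }) , dis
between (suc k) (false ∷ S) (true ∷ D) S∩D s≤k (s≤s l) | inj₁ s<k
  with between (suc k) S D S∩D s≤k l
... | B , e , sub , dis = false ∷ B , e , (λ { {suc i} p → sub {i} p }) , dis
between (suc k) (false ∷ S) (false ∷ D) S∩D s≤k l | inj₁ (s≤s s≤k′)
  with between k S D S∩D s≤k′ (≤-pred (≤-trans (≤-reflexive (sym (+-suc ∣ D ∣ k))) l))
... | B , e , sub , dis = true ∷ B , cong suc e , (λ { {suc i} p → sub {i} p }) , dis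

∣[]≔true∣ : ∀ {n} (A : Subset n) x → ∣ A [ x ]≔ true ∣ ≤ suc ∣ A ∣
∣[]≔true∣ (true ∷ A)  zero    = n≤1+n _
∣[]≔true∣ (false ∷ A) zero    = ≤-refl
∣[]≔true∣ (true ∷ A)  (suc x) = s≤s (∣[]≔true∣ A x)
∣[]≔true∣ (false ∷ A) (suc x) = ∣[]≔true∣ A x

-- The size of a family

cnt : ∀ {n} → Fam n → ℕ
cnt {zero}  F = if F [] then 1 else 0
cnt {suc n} F = cnt (λ A → F (true ∷ A)) + cnt (λ A → F (false ∷ A))

-- F(x) and F(x̄), both on the ground set without `x`.
link del : ∀ {n} → Fin (suc n) → Fam (suc n) → Fam n
link x F A = F (ins x true A)
del  x F A = F (ins x false A)

cnt-split : ∀ {n} x (F : Fam (suc n)) → cnt F ≡ cnt (link x F) + cnt (del x F)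
cnt-split zero F = refl
cnt-split {suc n} (suc x) F
  rewrite cnt-split x (λ A → F (true ∷ A)) | cnt-split x (λ A → F (false ∷ A)) =
  medial (cnt (λ A → F (true ∷ ins x true A))) _ _ _

cnt-mono : ∀ {n} {F G : Fam n} → F ⊆ᶠ G → cnt F ≤ cnt G
cnt-mono {zero} {F} {G} F⊆G with F [] in e
... | false = z≤n
... | true rewrite F⊆G [] e = ≤-refl
cnt-mono {suc n} F⊆G = +-mono-≤ (cnt-mono (F⊆G ∘ (true ∷_))) (cnt-mono (F⊆G ∘ (false ∷_)))

cnt-strict : ∀ {n} {F G : Fam n} → F ⊆ᶠ G → ∀ A → G ∋ A → F A ≡ false → cnt F < cnt G
cnt-strict {zero} F⊆G [] GA FA rewrite GA | FA = ≤-refl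
cnt-strict {suc n} F⊆G (true ∷ A)  GA FA =
  +-mono-<-≤ (cnt-strict (F⊆G ∘ (true ∷_)) A GA FA) (cnt-mono (F⊆G ∘ (false ∷_)))
cnt-strict {suc n} F⊆G (false ∷ A) GA FA =
  +-mono-≤-< (cnt-mono (F⊆G ∘ (true ∷_))) (cnt-strict (F⊆G ∘ (false ∷_)) A GA FA)

cnt-empty : ∀ {n} {F : Fam n} → ¬ NE F → cnt F ≡ 0
cnt-empty {zero} {F} ¬F with F [] in e
... | true  = contradiction ([] , e) ¬F
... | false = refl
cnt-empty {suc n} ¬F = cong₂ _+_ (cnt-empty λ { (A , p) → ¬F (true ∷ A , p) }) (cnt-empty λ { (A , p) → ¬F (false ∷ A , p) })

cnt-modular : ∀ {n} (F G : Fam n) → cnt (λ A → F A ∧ G A) + cnt (λ A → F A ∨ G A) ≡ cnt F + cnt G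
cnt-modular {zero} F G with F [] | G []
... | true  | true  = refl
... | true  | false = refl
... | false | true  = refl
... | false | false = refl
cnt-modular {suc n} F G = begin
  _ ≡⟨ medial (cnt (λ A → F (true ∷ A) ∧ G (true ∷ A))) _ _ _ ⟩
  _ ≡⟨ cong₂ _+_ (cnt-modular (F ∘ (true ∷_)) (G ∘ (true ∷_))) (cnt-modular (F ∘ (false ∷_)) (G ∘ (false ∷_))) ⟩
  _ ≡⟨ medial (cnt (F ∘ (true ∷_))) _ _ _ ⟩
  _ ∎
  where
  open ≡-Reasoning

cnt⁻¹ : ∀ {n} (F : Fam n) → 1 ≤ cnt F → NE F
cnt⁻¹ {zero} F l with F [] in e
... | true = [] , e
cnt⁻¹ {suc n} F l with cnt (λ A → F (true ∷ A)) in e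
... | suc _ = let A , p = cnt⁻¹ (λ A → F (true ∷ A)) (≤-trans (s≤s z≤n) (≤-reflexive (sym e))) in true ∷ A , p
... | zero  = let A , p = cnt⁻¹ (λ A → F (false ∷ A)) l in false ∷ A , p

NE? : ∀ {n} (F : Fam n) → Dec (NE F)
NE? F with cnt F in e
... | suc _ = yes (cnt⁻¹ F (≤-trans (s≤s z≤n) (≤-reflexive (sym e))))
... | zero  = no λ { (A , p) → <⇒≱ (≤-<-trans z≤n (cnt-strict {F = λ _ → false} {F} (λ _ ()) A p refl)) (≤-reflexive e) }

cnt-pos : ∀ {n} {F : Fam n} → NE F → 1 ≤ cnt F
cnt-pos {F = F} (A , p) = ≤-trans (s≤s z≤n) (cnt-strict {F = λ _ → false} {F} (λ _ ()) A p refl)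

two-members : ∀ {n} (F : Fam n) → 2 ≤ cnt F → ∃₂ λ A B → A ≢ B × F ∋ A × F ∋ B
two-members {zero} F l with F []
two-members {zero} F (s≤s ()) | true
two-members {zero} F () | false
two-members {suc n} F l with 2 ≤? cnt (λ A → F (true ∷ A)) | 2 ≤? cnt (λ A → F (false ∷ A))
... | yes l₁ | _ = let A , B , ne , p , q = two-members (λ A → F (true ∷ A)) l₁
                   in true ∷ A , true ∷ B , (ne ∘ ∷-injectiveʳ) , p , q
... | no _ | yes l₀ = let A , B , ne , p , q = two-members (λ A → F (false ∷ A)) l₀
                      in false ∷ A , false ∷ B , (ne ∘ ∷-injectiveʳ) , p , q
... | no l₁ | no l₀ =
  let A , p = cnt⁻¹ (λ A → F (true ∷ A)) (+-cancelʳ-≤ 1 1 _ (≤-trans l (+-monoʳ-≤ _ (≤-pred (≰⇒> l₀)))))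
      B , q = cnt⁻¹ (λ A → F (false ∷ A)) (+-cancelˡ-≤ 1 1 _ (≤-trans l (+-monoˡ-≤ _ (≤-pred (≰⇒> l₁)))))
  in true ∷ A , false ∷ B , (λ ()) , p , q

cnt-link : ∀ {n} x (F : Fam (suc n)) → ¬ NE (del x F) → cnt F ≡ cnt (link x F)
cnt-link x F ¬del = trans (cnt-split x F) (trans (cong (cnt (link x F) +_) (cnt-empty ¬del)) (+-identityʳ _))

_≟ˢ_ : ∀ {n} (A B : Subset n) → Dec (A ≡ B)
_≟ˢ_ = ≡-dec _≟ᵇ_

_without_ : ∀ {n} → Fam n → Subset n → Fam n
(F without A) X = F X ∧ not ⌊ X ≟ˢ A ⌋

without⁺ : ∀ {n} (F : Fam n) {A X} → F ∋ X → X ≢ A → F without A ∋ X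
without⁺ F {A} {X} p ne with X ≟ˢ A
... | yes e = contradiction e ne
... | no _  = ∧-true p refl

cnt-without : ∀ {n} (F : Fam n) {A} → F ∋ A → cnt (F without A) < cnt F
cnt-without F {A} p = cnt-strict (λ X q → proj₁ (∧-split (F X) q)) A p (helper p)
  where
  helper : F ∋ A → (F without A) A ≡ false
  helper p with A ≟ˢ A
  ... | yes _ = ¬true→false λ q → true≢false (proj₂ (∧-split (F A) q)) refl
  ... | no ne = contradiction refl ne

cnt≥2 : ∀ {n} (F : Fam n) {A B} → A ≢ B → F ∋ A → F ∋ B → 2 ≤ cnt F
cnt≥2 F {A} {B} ne p q = ≤-trans (s≤s (cnt-pos (B , without⁺ F q (ne ∘ sym)))) (cnt-without F p)

-- Cross-intersecting and nontrivial families, and how they split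

Cross : ∀ {n} → Fam n → Fam n → Set
Cross F G = ∀ A B → F ∋ A → G ∋ B → meets A B ≡ true

Hits : ∀ {n} → Fam n → Subset n → Set
Hits F V = ∀ A → F ∋ A → meets A V ≡ true

NT : ∀ {n} → Fam n → Set
NT F = ∀ x → ∃ λ A → F ∋ A × lookup A x ≡ false

Cross-sym : ∀ {n} {F G : Fam n} → Cross F G → Cross G F
Cross-sym c A B p q = trans (meets-sym A B) (c B A q p)

module _ {n} {F : Fam (suc n)} (x : Fin (suc n)) where

  unif-link : ∀ {k} → Unif (suc k) F → Unif k (link x F)
  unif-link u A p = ∣ins-true∣⁻¹ x A (u _ p)

  unif-del : ∀ {k} → Unif k F → Unif k (del x F)
  unif-del u A p = trans (sym (∣ins-false∣ x A)) (u _ p)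

  cross-link-del : ∀ {G} → Cross F G → Cross (link x F) (del x G)
  cross-link-del c A B p q = trans (sym (meets-ins x true false A B)) (c _ _ p q)

  cross-del-link : ∀ {G} → Cross F G → Cross (del x F) (link x G)
  cross-del-link c A B p q = trans (sym (meets-ins x false true A B)) (c _ _ p q)

  cross-del-del : ∀ {G} → Cross F G → Cross (del x F) (del x G)
  cross-del-del c A B p q = trans (sym (meets-ins x false false A B)) (c _ _ p q)

  NE-link : ∀ A → F ∋ A → lookup A x ≡ true → NE (link x F)
  NE-link A p a with view x A
  ... | at true A′  = A′ , p
  ... | at false A′ = true≢false a (insertAt-lookup A′ x false)

  NE-del : ∀ A → F ∋ A → lookup A x ≡ false → NE (del x F)
  NE-del A p a with view x A
  ... | at false A′ = A′ , p
  ... | at true A′  = true≢false (insertAt-lookup A′ x true) a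

  hits-del : ∀ {b V} → Hits F (ins x b V) → Hits (del x F) V
  hits-del {b} {V} hit A p = trans (sym (meets-ins x false b A V)) (hit _ p)

  hits-link : ∀ {V} → Hits F (ins x false V) → Hits (link x F) V
  hits-link {V} hit A p = trans (sym (meets-ins x true false A V)) (hit _ p)

-- Shifting

cnt-cong : ∀ {n} {F G : Fam n} → (∀ A → F A ≡ G A) → cnt F ≡ cnt G
cnt-cong {zero}  e = cong (if_then 1 else 0) (e [])
cnt-cong {suc n} e = cong₂ _+_ (cnt-cong (e ∘ (true ∷_))) (cnt-cong (e ∘ (false ∷_)))

ins-≔ : ∀ {n} i b c (A : Subset n) → ins i b A [ i ]≔ c ≡ ins i c A
ins-≔ zero    b c A       = refl
ins-≔ (suc i) b c (a ∷ A) = cong (a ∷_) (ins-≔ i b c A)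

∈-≔false : ∀ {n} (A : Subset n) i {x} → lookup (A [ i ]≔ false) x ≡ true → x ≢ i × lookup A x ≡ true
∈-≔false A i {x} e with x ≟ᶠ i
... | yes refl = true≢false e (lookup∘update i A false)
... | no x≢i   = x≢i , trans (sym (lookup∘update′ x≢i A false)) e

∈-≔true : ∀ {n} (A : Subset n) i {x} → x ≢ i → lookup (A [ i ]≔ true) x ≡ true → lookup A x ≡ true
∈-≔true A i x≢i e = trans (sym (lookup∘update′ x≢i A true)) e

-- F₁ = F(w) and F₀ = F(w̄); lower and raise are the two layers of the shift S_{iw}(F).
lower raise : ∀ {n} → Fin n → Fam n → Fam n → Fam n
lower i F₁ F₀ A = F₁ A ∧ (lookup A i ∨ F₀ (A [ i ]≔ true))
raise i F₁ F₀ A = (lookup A i ∧ F₁ (A [ i ]≔ false)) ∨ F₀ A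

module _ {n} (i : Fin n) (F₁ F₀ : Fam n) where

  lower-elim : ∀ A → lower i F₁ F₀ ∋ A → F₁ ∋ A × (lookup A i ≡ true ⊎ F₀ ∋ (A [ i ]≔ true))
  lower-elim A p with ∧-split (F₁ A) p
  ... | q , r = q , ∨-true (lookup A i) r

  raise-elim : ∀ A → raise i F₁ F₀ ∋ A → (lookup A i ≡ true × F₁ ∋ (A [ i ]≔ false)) ⊎ F₀ ∋ A
  raise-elim A p with ∨-true (lookup A i ∧ F₁ (A [ i ]≔ false)) p
  ... | inj₁ q = inj₁ (∧-split (lookup A i) q)
  ... | inj₂ q = inj₂ q

  unif-raise : ∀ {a} → Unif a F₁ → Unif (suc a) F₀ → Unif (suc a) (raise i F₁ F₀)
  unif-raise u₁ u₀ A p with raise-elim A p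
  ... | inj₂ q       = u₀ A q
  ... | inj₁ (a , q) = trans (size A i a) (cong suc (u₁ _ q))
    where
    size : ∀ {n} (A : Subset n) i → lookup A i ≡ true → ∣ A ∣ ≡ suc ∣ A [ i ]≔ false ∣
    size (true ∷ A)  zero    e = refl
    size (true ∷ A)  (suc i) e = cong suc (size A i e)
    size (false ∷ A) (suc i) e = size A i e

-- Split at `i`, the shift replaces F₁(ī) and F₀(i) by their intersection and their union and leaves
-- the other two parts unchanged.
cnt-shift : ∀ {n} i (F₁ F₀ : Fam n) → cnt (lower i F₁ F₀) + cnt (raise i F₁ F₀) ≡ cnt F₁ + cnt F₀
cnt-shift {suc n} i F₁ F₀ = begin
  cnt L + cnt R
    ≡⟨ cong₂ _+_ (cnt-split i L) (cnt-split i R) ⟩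
  (cnt (link i L) + cnt (del i L)) + (cnt (link i R) + cnt (del i R))
    ≡⟨ cong₂ _+_ (cong₂ _+_ (cnt-cong eq₁) (cnt-cong eq₂)) (cong₂ _+_ (cnt-cong eq₃) (cnt-cong eq₄)) ⟩
  (cnt (link i F₁) + cnt (λ A → del i F₁ A ∧ link i F₀ A)) + (cnt (λ A → del i F₁ A ∨ link i F₀ A) + cnt (del i F₀))
    ≡⟨ shuffle₁ (cnt (link i F₁)) _ _ _ ⟩
  cnt (link i F₁) + (cnt (λ A → del i F₁ A ∧ link i F₀ A) + cnt (λ A → del i F₁ A ∨ link i F₀ A)) + cnt (del i F₀)
    ≡⟨ cong (λ z → cnt (link i F₁) + z + cnt (del i F₀)) (cnt-modular (del i F₁) (link i F₀)) ⟩
  cnt (link i F₁) + (cnt (del i F₁) + cnt (link i F₀)) + cnt (del i F₀)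
    ≡⟨ shuffle₂ (cnt (link i F₁)) _ _ _ ⟩
  (cnt (link i F₁) + cnt (del i F₁)) + (cnt (link i F₀) + cnt (del i F₀))
    ≡⟨ sym (cong₂ _+_ (cnt-split i F₁) (cnt-split i F₀)) ⟩
  cnt F₁ + cnt F₀ ∎
  where
  open ≡-Reasoning
  L = lower i F₁ F₀
  R = raise i F₁ F₀
  shuffle₁ : ∀ a b c d → (a + b) + (c + d) ≡ a + (b + c) + d
  shuffle₁ = solve-∀
  shuffle₂ : ∀ a b c d → a + (b + c) + d ≡ (a + b) + (c + d)
  shuffle₂ = solve-∀
  eq₁ : ∀ A → link i L A ≡ link i F₁ A
  eq₁ A rewrite insertAt-lookup A i true = ∧-identityʳ _
  eq₂ : ∀ A → del i L A ≡ del i F₁ A ∧ link i F₀ A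
  eq₂ A rewrite insertAt-lookup A i false | ins-≔ i false true A = refl
  eq₃ : ∀ A → link i R A ≡ del i F₁ A ∨ link i F₀ A
  eq₃ A rewrite insertAt-lookup A i true | ins-≔ i true false A = refl
  eq₄ : ∀ A → del i R A ≡ del i F₀ A
  eq₄ A rewrite insertAt-lookup A i false = refl

module _ {n} (i : Fin n) {F₁ F₀ G₁ G₀ : Fam n} where

  cross-raise-raise : Cross F₁ G₀ → Cross F₀ G₁ → Cross F₀ G₀ → Cross (raise i F₁ F₀) (raise i G₁ G₀)
  cross-raise-raise c₁₀ c₀₁ c₀₀ A B p q with raise-elim i F₁ F₀ A p | raise-elim i G₁ G₀ B q
  ... | inj₁ (a , _) | inj₁ (b , _) = meets-at A B i a b
  ... | inj₂ p′ | inj₂ q′ = c₀₀ A B p′ q′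
  ... | inj₁ (_ , p′) | inj₂ q′ =
    let x , xA , xB = point (A [ i ]≔ false) B (c₁₀ _ _ p′ q′)
    in meets-at A B x (proj₂ (∈-≔false A i xA)) xB
  ... | inj₂ p′ | inj₁ (_ , q′) =
    let x , xA , xB = point A (B [ i ]≔ false) (c₀₁ _ _ p′ q′)
    in meets-at A B x xA (proj₂ (∈-≔false B i xB))

  -- The delicate case is an `A` that stays in F₁ although it may miss `i`: then A ∪ {i} lies in F₀
  -- and meets B without `i`, so already `A` meets `B`.
  cross-lower-raise : Cross F₁ G₀ → Cross F₀ G₁ → Cross (lower i F₁ F₀) (raise i G₁ G₀)
  cross-lower-raise c₁₀ c₀₁ A B p q with lower-elim i F₁ F₀ A p | raise-elim i G₁ G₀ B q
  ... | p′ , _ | inj₂ q′ = c₁₀ A B p′ q′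
  ... | _ , inj₁ a | inj₁ (b , _) = meets-at A B i a b
  ... | _ , inj₂ p′ | inj₁ (_ , q′) =
    let x , xA , xB = point (A [ i ]≔ true) (B [ i ]≔ false) (c₀₁ _ _ p′ q′)
        x≢i , xB′   = ∈-≔false B i xB
    in meets-at A B x (∈-≔true A i x≢i xA) xB′

-- F(w), F(w̄), G(w) and G(w̄). Members of F₁ and G₁ have `w` in common before it is removed, so
-- nothing is known about the pair of F₁ and G₁.
record Layers (n a b : ℕ) : Set where
  field
    F₁ F₀ G₁ G₀ : Fam n
    unifF₁ : Unif a F₁
    unifF₀ : Unif (suc a) F₀
    unifG₁ : Unif b G₁
    unifG₀ : Unif (suc b) G₀
    cross₁₀ : Cross F₁ G₀
    cross₀₁ : Cross F₀ G₁
    cross₀₀ : Cross F₀ G₀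

layers : ∀ {n a b} x {F G : Fam (suc n)} → Unif (suc a) F → Unif (suc b) G → Cross F G → Layers n a b
layers x {F} {G} uF uG c = record
  { F₁ = link x F ; F₀ = del x F ; G₁ = link x G ; G₀ = del x G
  ; unifF₁ = unif-link x uF ; unifF₀ = unif-del x uF ; unifG₁ = unif-link x uG ; unifG₀ = unif-del x uG
  ; cross₁₀ = cross-link-del x c ; cross₀₁ = cross-del-link x c ; cross₀₀ = cross-del-del x c }

shift : ∀ {n a b} → Fin n → Layers n a b → Layers n a b
shift i L = record
  { F₁ = lower i F₁ F₀ ; F₀ = raise i F₁ F₀ ; G₁ = lower i G₁ G₀ ; G₀ = raise i G₁ G₀
  ; unifF₁ = λ A → unifF₁ A ∘ proj₁ ∘ lower-elim i F₁ F₀ A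
  ; unifF₀ = unif-raise i F₁ F₀ unifF₁ unifF₀
  ; unifG₁ = λ A → unifG₁ A ∘ proj₁ ∘ lower-elim i G₁ G₀ A
  ; unifG₀ = unif-raise i G₁ G₀ unifG₁ unifG₀
  ; cross₁₀ = cross-lower-raise i cross₁₀ cross₀₁
  ; cross₀₁ = Cross-sym (cross-lower-raise i (Cross-sym cross₀₁) (Cross-sym cross₁₀))
  ; cross₀₀ = cross-raise-raise i cross₁₀ cross₀₁ cross₀₀ }
  where open Layers L

-- The outcome of repeated shifting. Since F₀ and G₀ only grow, they stay nonempty or nontrivial if
-- they were so before.
record Stabilised {n a b} (L : Layers n a b) : Set where
  open Layers L
  field
    result : Layers n a b
  module R = Layers result
  field
    cross₁₁ : Cross R.F₁ R.G₁
    F₀⊆ : F₀ ⊆ᶠ R.F₀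
    G₀⊆ : G₀ ⊆ᶠ R.G₀
    cntF : cnt R.F₁ + cnt R.F₀ ≡ cnt F₁ + cnt F₀
    cntG : cnt R.G₁ + cnt R.G₀ ≡ cnt G₁ + cnt G₀

-- If A ∈ F₁ and B ∈ G₁ are disjoint, shifting to an i outside both expels A from F₁.
stabilise : ∀ {n a b} (L : Layers n a b) → a + b < n → Stabilised L
stabilise {n} {a} {b} L a+b<n = go L (<-wellFounded _)
  where
  -- The recursion is on the size of F₁: `lower` keeps only members of F₁ and loses `A`.
  go : ∀ L → Acc _<_ (cnt (Layers.F₁ L)) → Stabilised L
  go L (acc rs) with anySubset? (λ A → (F₁ A ≟ᵇ true) ×-dec anySubset? (λ B → (G₁ B ≟ᵇ true) ×-dec (meets A B ≟ᵇ false)))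
    where open Layers L
  ... | no ∄ = record
    { result = L
    ; cross₁₁ = λ A B p q → ¬false→true λ e → ∄ (A , p , B , q , e)
    ; F₀⊆ = λ _ p → p ; G₀⊆ = λ _ p → p ; cntF = refl ; cntG = refl }
  ... | yes (A , p , B , q , disjoint) = record
    { Stabilised S
    ; F₀⊆ = λ X r → Stabilised.F₀⊆ S X (∨-trueʳ _ r)
    ; G₀⊆ = λ X r → Stabilised.G₀⊆ S X (∨-trueʳ _ r)
    ; cntF = trans (Stabilised.cntF S) (cnt-shift i F₁ F₀)
    ; cntG = trans (Stabilised.cntG S) (cnt-shift i G₁ G₀) }
    where
    open Layers L
    free = outside-both A B (subst (_< n) (sym (cong₂ _+_ (unifF₁ A p) (unifG₁ B q))) a+b<n)
    i = proj₁ free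
    A∌i = proj₁ (proj₂ free)
    B∌i = proj₂ (proj₂ free)
    -- If `A` stayed, A ∪ {i} in F₀ would meet `B`; as `i` is not in `B`, already `A` would meet
    -- `B`.
    expelled : lower i F₁ F₀ A ≡ false
    expelled = ¬true→false absurd
      where
      absurd : ¬ (lower i F₁ F₀ ∋ A)
      absurd r with lower-elim i F₁ F₀ A r
      ... | _ , inj₁ a = true≢false a A∌i
      ... | _ , inj₂ r′ with point (A [ i ]≔ true) B (cross₀₁ _ _ r′ q)
      ... | x , xA , xB with x ≟ᶠ i
      ... | yes refl = true≢false xB B∌i
      ... | no x≢i   = true≢false (meets-at A B x (∈-≔true A i x≢i xA) xB) disjoint
    S : Stabilised (shift i L)
    S = go (shift i L) (rs (cnt-strict (λ X r → proj₁ (∧-split (F₁ X) r)) A p expelled))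

total : ∀ {n a b} → Layers n a b → ℕ
total L = (cnt F₁ + cnt G₁) + (cnt F₀ + cnt G₀)
  where open Layers L

total-stabilised : ∀ {n a b} {L : Layers n a b} (S : Stabilised L) → total (Stabilised.result S) ≡ total L
total-stabilised {L = L} S = begin
  (cnt R.F₁ + cnt R.G₁) + (cnt R.F₀ + cnt R.G₀) ≡⟨ medial (cnt R.F₁) _ _ _ ⟩
  (cnt R.F₁ + cnt R.F₀) + (cnt R.G₁ + cnt R.G₀) ≡⟨ cong₂ _+_ cntF cntG ⟩
  (cnt F₁ + cnt F₀) + (cnt G₁ + cnt G₀)         ≡⟨ medial (cnt F₁) _ _ _ ⟩
  (cnt F₁ + cnt G₁) + (cnt F₀ + cnt G₀) ∎
  where
  open ≡-Reasoning
  open Layers L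
  open Stabilised S

-- Nonempty cross-intersecting families

unif-empty : ∀ {n k} {F : Fam n} → (n < k) → Unif k F → ¬ NE F
unif-empty n<k u (A , p) = <⇒≱ n<k (subst (_≤ _) (u A p) (∣p∣≤n A))

link-empty : ∀ {n} x {F : Fam (suc n)} → Unif 0 F → ¬ NE (link x F)
link-empty x u (A , p) = 0≢1+n (trans (sym (u _ p)) (∣ins-true∣ x A))

unif-bound : ∀ {n} k {F : Fam n} → Unif k F → cnt F ≤ bin n k
unif-bound {zero} zero {F} u with F []
... | true  = ≤-refl
... | false = z≤n
unif-bound {zero} (suc k) u = ≤-reflexive (cnt-empty (unif-empty (s≤s z≤n) u))
unif-bound {suc n} zero u
  rewrite cnt-empty (link-empty zero u) = unif-bound 0 (unif-del zero u)
unif-bound {suc n} (suc k) u = +-mono-≤ (unif-bound k (unif-link zero u)) (unif-bound (suc k) (unif-del zero u))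

-- At an element `v` of `V`, the sets through `v` are bounded by all sets and the others still hit
-- the rest of `V`.
hits-bound : ∀ {n} p k {F : Fam n} V → Unif k F → Hits F V → ∣ V ∣ ≤ p → cnt F ≤ h n p k
hits-bound p k V u hit V≤p with ∣ V ∣ in eV
... | zero = ≤-trans (≤-reflexive (cnt-empty λ { (A , q) → true≢false (hit A q) (meets-∅ A V eV) })) z≤n
hits-bound {n} (suc p) k V u hit V≤p | suc s with element V eV
hits-bound {suc n} (suc p) k {F} V u hit V≤p | suc s | v , _ with view v V
hits-bound {suc n} (suc p) k V u hit V≤p | suc s | v , v∈ | at false V′ =
  true≢false v∈ (insertAt-lookup V′ v false)
hits-bound {suc n} (suc p) k {F} V u hit (s≤s V≤p) | suc s | v , _ | at true V′
  rewrite cnt-split v F = bound k u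
  where
  V′≤p : ∣ V′ ∣ ≤ p
  V′≤p = ≤-trans (≤-reflexive (∣ins-true∣⁻¹ v V′ eV)) V≤p
  bound : ∀ k → Unif k F → cnt (link v F) + cnt (del v F) ≤ h (suc n) (suc p) k
  bound zero u rewrite cnt-empty (link-empty v u) =
    ≤-trans (hits-bound p 0 V′ (unif-del v u) (hits-del v hit) V′≤p) (≤-reflexive (h-zero n p))
  bound (suc k) u =
    +-mono-≤ (unif-bound k (unif-link v u)) (hits-bound p (suc k) V′ (unif-del v u) (hits-del v hit) V′≤p)

interchange : ∀ a b c d → (a + b) + (c + d) ≡ (a + d) + (b + c)
interchange = solve-∀

cnt-cross-split : ∀ {n} x (F G : Fam (suc n)) →
  cnt F + cnt G ≡ (cnt (link x F) + cnt (del x G)) + (cnt (del x F) + cnt (link x G))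
cnt-cross-split x F G = trans (cong₂ _+_ (cnt-split x F) (cnt-split x G)) (interchange (cnt (link x F)) _ _ _)

cnt-layer-split : ∀ {n} x (F G : Fam (suc n)) →
  cnt F + cnt G ≡ (cnt (link x F) + cnt (link x G)) + (cnt (del x F) + cnt (del x G))
cnt-layer-split x F G = trans (cong₂ _+_ (cnt-split x F) (cnt-split x G)) (medial (cnt (link x F)) _ _ _)

suc-h≤bin : ∀ {n k ℓ} → k + ℓ ≤ n → suc (h n ℓ k) ≤ bin n k
suc-h≤bin {n} {k} {ℓ} le = begin
  suc (h n ℓ k)              ≡⟨ +-comm 1 _ ⟩
  h n ℓ k + 1                ≤⟨ +-monoʳ-≤ (h n ℓ k) (bin-pos (m+n≤o⇒m≤o∸n k le)) ⟩
  h n ℓ k + bin (n ∸ ℓ) k    ≡⟨ h+bin k (≤-trans (m≤n+m ℓ k) le) ⟩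
  bin n k ∎
  where open ≤-Reasoning

-- With G empty, or F empty and k = ℓ, a single uniform family remains. Otherwise `cross-bound-NE`
-- applies, and its bound is at most C(n,k) because some k-set misses a given ℓ-set.
cross-bound : ∀ n {k ℓ} → ℓ ≤ k → k + ℓ ≤ n → {F G : Fam n} → Unif k F → Unif ℓ G → Cross F G →
  cnt F + cnt G ≤ bin n k

-- The classical estimate C(n,k) - C(n-ℓ,k) + 1. For ℓ < k, split at an element `u` of a member of
-- G: `cross-bound` covers F(u) and G(ū), induction covers F(ū) and G(u). For k = ℓ, either n = 2k,
-- or shifting leads to a smaller ground set.
cross-bound-NE : ∀ n {k ℓ} → ℓ ≤ k → k + ℓ ≤ n → {F G : Fam n} → Unif k F → Unif ℓ G → Cross F G →
  NE G → (k ≡ ℓ → NE F) → cnt F + cnt G ≤ suc (h n ℓ k)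

cross-bound n {k} {ℓ} ℓ≤k le {F} {G} uF uG c with NE? G | NE? F | m≤n⇒m<n∨m≡n ℓ≤k
... | no ¬G | _ | _ rewrite cnt-empty ¬G | +-identityʳ (cnt F) = unif-bound k uF
... | yes neG | _ | inj₁ ℓ<k =
  ≤-trans (cross-bound-NE n ℓ≤k le uF uG c neG λ e → contradiction (sym e) (<⇒≢ ℓ<k)) (suc-h≤bin {ℓ = ℓ} le)
... | yes neG | yes neF | inj₂ _ = ≤-trans (cross-bound-NE n ℓ≤k le uF uG c neG λ _ → neF) (suc-h≤bin {ℓ = ℓ} le)
... | yes _ | no ¬F | inj₂ refl rewrite cnt-empty ¬F = unif-bound k uG

cross-bound-NE n {k} {zero} ℓ≤k le {F} {G} uF uG c (U , p) neF
  rewrite cnt-empty {F = F} (λ { (A , q) → true≢false (c A U q p) (meets-∅ A U (uG U p)) }) = unif-bound 0 uG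
cross-bound-NE (suc N) {suc k} {suc ℓ} (s≤s ℓ≤k) (s≤s le) {F} {G} uF uG c (U , p) neF with m≤n⇒m<n∨m≡n ℓ≤k
... | inj₁ ℓ<k = let u , u∈ = element U (uG U p) in begin
  cnt F + cnt G
    ≡⟨ cnt-cross-split u F G ⟩
  (cnt (link u F) + cnt (del u G)) + (cnt (del u F) + cnt (link u G))
    ≤⟨ +-mono-≤ (cross-bound N ℓ<k le (unif-link u uF) (unif-del u uG) (cross-link-del u c))
                (cross-bound-NE N (<⇒≤ (m≤n⇒m≤1+n ℓ<k)) le′ (unif-del u uF) (unif-link u uG) (cross-del-link u c)
                  (NE-link {F = G} u U p u∈) λ e → contradiction (sym e) (<⇒≢ (m≤n⇒m≤1+n ℓ<k))) ⟩
  bin N k + suc (h N ℓ (suc k))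
    ≡⟨ +-suc (bin N k) _ ⟩
  suc (bin N k + h N ℓ (suc k)) ∎
  where
  open ≤-Reasoning
  le′ : suc k + ℓ ≤ N
  le′ = ≤-trans (≤-reflexive (sym (+-suc k ℓ))) le
... | inj₂ refl with m≤n⇒m<n∨m≡n le
-- Here the ground set is twice as large as the members. After any split, both pairs have sizes
-- adding up to `N`, and the resulting total is one more than `h` because only one set misses a
-- given set of half the size.
...   | inj₂ refl = begin
  cnt F + cnt G
    ≡⟨ cnt-cross-split zero F G ⟩
  (cnt (link zero F) + cnt (del zero G)) + (cnt (del zero F) + cnt (link zero G))
    ≡⟨ cong (_+ (cnt (del zero F) + cnt (link zero G))) (+-comm (cnt (link zero F)) _) ⟩
  (cnt (del zero G) + cnt (link zero F)) + (cnt (del zero F) + cnt (link zero G))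
    ≤⟨ +-mono-≤ (cross-bound N (n≤1+n k) le′ (unif-del zero uG) (unif-link zero uF) (Cross-sym (cross-link-del zero c)))
                (cross-bound N (n≤1+n k) le′ (unif-del zero uF) (unif-link zero uG) (cross-del-link zero c)) ⟩
  bin N (suc k) + bin N (suc k)
    ≡⟨ cong (_+ bin N (suc k)) (sym (bin-sym k (suc k))) ⟩
  bin N k + bin N (suc k)
    ≡⟨ sym (h+bin {suc N} {suc k} (suc k) (s≤s (m≤m+n k (suc k)))) ⟩
  h (suc N) (suc k) (suc k) + bin (N ∸ k) (suc k)
    ≡⟨ cong (λ z → h (suc N) (suc k) (suc k) + bin z (suc k)) (m+n∸m≡n k (suc k)) ⟩
  h (suc N) (suc k) (suc k) + bin (suc k) (suc k)
    ≡⟨ cong (h (suc N) (suc k) (suc k) +_) (bin-full (suc k)) ⟩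
  h (suc N) (suc k) (suc k) + 1
    ≡⟨ +-comm _ 1 ⟩
  suc (h (suc N) (suc k) (suc k)) ∎
  where
  open ≤-Reasoning
  le′ : suc k + k ≤ N
  le′ = ≤-reflexive (sym (+-suc k k))
-- The element `w` is missed by a member of each family, so F(w̄) and G(w̄) are nonempty.
...   | inj₁ lt = begin
  cnt F + cnt G
    ≡⟨ cnt-layer-split w F G ⟩
  (cnt (link w F) + cnt (link w G)) + (cnt (del w F) + cnt (del w G))
    ≡⟨ sym (total-stabilised S) ⟩
  (cnt R.F₁ + cnt R.G₁) + (cnt R.F₀ + cnt R.G₀)
    ≤⟨ +-mono-≤ (top (NE? R.F₁) (NE? R.G₁)) (cross-bound-NE N ≤-refl le″ R.unifF₀ R.unifG₀ R.cross₀₀ neG₀ λ _ → neF₀) ⟩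
  h N (suc k) k + suc (h N (suc k) (suc k))
    ≡⟨ trans (+-suc _ _) (cong suc (trans (+-comm (h N (suc k) k) _) (sym (h-pascal k (m+n≤o⇒n≤o (suc k) le″))))) ⟩
  suc (h (suc N) (suc k) (suc k)) ∎
  where
  open ≤-Reasoning
  A = proj₁ (neF refl)
  A∈ = proj₂ (neF refl)
  le″ : suc k + suc k ≤ N
  le″ = lt
  free = outside-both A U (s≤s (subst (_≤ N) (sym (cong₂ _+_ (uF A A∈) (uG U p))) le″))
  w = proj₁ free
  k+k<N : k + k < N
  k+k<N = ≤-trans (s≤s (+-monoʳ-≤ k (n≤1+n k))) le″
  S = stabilise (layers w uF uG c) k+k<N
  open Stabilised S
  neF₀ : NE R.F₀
  neF₀ = let X , q = NE-del {F = F} w A A∈ (proj₁ (proj₂ free)) in X , F₀⊆ X q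
  neG₀ : NE R.G₀
  neG₀ = let X , q = NE-del {F = G} w U p (proj₂ (proj₂ free)) in X , G₀⊆ X q
  -- If one of F₁ and G₁ is empty, the other one hits a member of the opposite G₀ or F₀. If neither
  -- is empty, the estimate for smaller sets is within the target.
  top : Dec (NE R.F₁) → Dec (NE R.G₁) → cnt R.F₁ + cnt R.G₁ ≤ h N (suc k) k
  top _ (no ¬G₁) = let V , q = neG₀ in
    subst (_≤ h N (suc k) k) (sym (trans (cong (cnt R.F₁ +_) (cnt-empty ¬G₁)) (+-identityʳ _)))
      (hits-bound (suc k) k V R.unifF₁ (λ X r → R.cross₁₀ X V r q) (≤-reflexive (R.unifG₀ V q)))
  top (no ¬F₁) (yes _) = let V , q = neF₀ in
    subst (_≤ h N (suc k) k) (sym (cong (_+ cnt R.G₁) (cnt-empty ¬F₁)))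
      (hits-bound (suc k) k V R.unifG₁ (λ X r → Cross-sym R.cross₀₁ X V r q) (≤-reflexive (R.unifF₀ V q)))
  top (yes neF₁) (yes neG₁) = ≤-trans (cross-bound-NE N ≤-refl (<⇒≤ k+k<N) R.unifF₁ R.unifG₁ cross₁₁ neG₁ λ _ → neF₁)
    (gap k k+k<N le″ neF₁ R.unifF₁)
    where
    gap : ∀ k → k + k < N → suc k + suc k ≤ N → NE R.F₁ → Unif k R.F₁ → suc (h N k k) ≤ h N (suc k) k
    gap zero _ _ (X , q) u = let Y , r = neG₁ in
      contradiction (cross₁₁ X Y q r) λ e → true≢false e (trans (meets-sym X Y) (meets-∅ Y X (u X q)))
    gap (suc k) lt _ _ _ = ≤-trans (≤-reflexive (+-comm 1 _)) (h-gap₁ k ≤-refl (<⇒≤ lt))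

-- Families hitting every member of a nontrivial family

-- Nontriviality of G as felt by F along `U`: `V` stands for a member of G missing `u`. Its size is
-- only bounded, because deleting an element may shrink it.
Avoid : ∀ {n} → ℕ → Fam n → Subset n → Set
Avoid p F U = ∀ u → lookup U u ≡ true → ∃ λ V → lookup V u ≡ false × ∣ V ∣ ≤ p × Hits F V

avoid-del : ∀ {n p b} {F : Fam (suc n)} u {U} → Avoid p F (ins u b U) → Avoid p (del u F) U
avoid-del {F = F} u {U} av x x∈ with av (punchIn u x) (trans (insertAt-punchIn U u _ x) x∈)
... | V , x∉ , V≤p , hit with view u V
... | at c V′ = V′ , trans (sym (insertAt-punchIn V′ u c x)) x∉ , ≤-trans (∣≤ins∣ u c V′) V≤p , hits-del {F = F} u hit

hits-empty : ∀ {n} {F : Fam n} U → ∣ U ∣ ≡ 0 → Hits F U → ¬ NE F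
hits-empty U U≡0 hit (A , p) = true≢false (hit A p) (meets-∅ A U U≡0)

unif0-hits : ∀ {n} {F : Fam n} U → Unif 0 F → Hits F U → ¬ NE F
unif0-hits U u hit (A , p) = true≢false (trans (meets-sym U A) (hit A p)) (meets-∅ U A (u A p))

-- Members of F through `u` must hit the set `V` that misses `u`, hence in another element.
avoid-link-bound : ∀ {n p k} {F : Fam (suc n)} u {U} → Unif (suc k) F → Avoid p F (ins u true U) →
  cnt (link u F) ≤ h n p k
avoid-link-bound {p = p} {k} {F} u {U} uF av with av u (insertAt-lookup U u true)
... | V , u∉ , V≤p , hit with view u V
... | at true V′  = true≢false (insertAt-lookup V′ u true) u∉
... | at false V′ =
  hits-bound p k V′ (unif-link u uF) (hits-link {F = F} u hit) (≤-trans (∣≤ins∣ u false V′) V≤p)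

-- Sets are sorted by their first element `u` in `U`, and `avoid-link-bound` bounds each class. The
-- sets `V` may vary with `u`, yet the total is the same as for one fixed set disjoint from `U`.
cover-bound : ∀ j {n p k} {F : Fam n} U → ∣ U ∣ ≡ j → Unif k F → Hits F U → Avoid p F U → cnt F ≤ m n j p k
cover-bound zero U U≡0 uF hit av = ≤-reflexive (cnt-empty (hits-empty U U≡0 hit))
cover-bound (suc j) {k = zero} U _ uF hit av = ≤-trans (≤-reflexive (cnt-empty (unif0-hits U uF hit))) z≤n
cover-bound (suc j) {zero} {k = suc k} [] ()
cover-bound (suc j) {suc n} {p} {suc k} {F} U ∣U∣ uF hit av with element U ∣U∣
... | u , u∈ with view u U
... | at false U′ = true≢false u∈ (insertAt-lookup U′ u false)
... | at true U′  = ≤-trans (≤-reflexive (cnt-split u F)) (+-mono-≤ (avoid-link-bound u uF av)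
  (cover-bound j U′ (∣ins-true∣⁻¹ u U′ ∣U∣) (unif-del u uF)
    (hits-del {F = F} u hit) (avoid-del {F = F} u av)))

-- `B` can be added to F while `hits-bound` continues to apply.
hits-bound-missing : ∀ {n p k} {F : Fam n} V B → Unif k F → Hits F V → ∣ V ∣ ≤ p →
  ∣ B ∣ ≡ k → meets B V ≡ true → F B ≡ false → suc (cnt F) ≤ h n p k
hits-bound-missing {p = p} {k} {F} V B uF hit V≤p ∣B∣ B∩V F∌B =
  ≤-trans (cnt-strict {F = F} {F⁺} (λ A q → cong (_∨ ⌊ A ≟ˢ B ⌋) q) B F⁺∋B F∌B) (hits-bound p k V unif⁺ hit⁺ V≤p)
  where
  F⁺ : Fam _
  F⁺ A = F A ∨ ⌊ A ≟ˢ B ⌋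
  split⁺ : ∀ A → F⁺ ∋ A → F ∋ A ⊎ A ≡ B
  split⁺ A q with F A | A ≟ˢ B
  ... | true | _ = inj₁ refl
  ... | false | yes e = inj₂ e
  F⁺∋B : F⁺ ∋ B
  F⁺∋B with B ≟ˢ B
  ... | yes _ = ∨-zeroʳ (F B)
  ... | no ne = contradiction refl ne
  unif⁺ : Unif k F⁺
  unif⁺ A q with split⁺ A q
  ... | inj₁ q′   = uF A q′
  ... | inj₂ refl = ∣B∣
  hit⁺ : Hits F⁺ V
  hit⁺ A q with split⁺ A q
  ... | inj₁ q′   = hit A q′
  ... | inj₂ refl = B∩V

-- A set through an element of `V` outside `W` that avoids `W` altogether is missing from F.
hits-two-bound : ∀ {n p k} {F : Fam n} V W → V ≢ W → ∣ V ∣ ≡ p → ∣ W ∣ ≡ p → suc k + p ≤ n →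
  Unif (suc k) F → Hits F V → Hits F W → suc (cnt F) ≤ h n p (suc k)
hits-two-bound {n} {p} {k} {F} V W V≢W ∣V∣ ∣W∣ le uF hitV hitW =
  let x , x∈V , x∉W = difference V W (≤-reflexive (trans ∣W∣ (sym ∣V∣))) V≢W
      B , ∣B∣ , x⊆ , B∩W = between (suc k) (⊥ [ x ]≔ true) W
        (¬true→false λ t → let y , y∈ , y∈W = point (⊥ [ x ]≔ true) W t in disjoint x x∉W y y∈ y∈W)
        (≤-trans (∣[]≔true∣ ⊥ x) (s≤s (subst (_≤ k) (sym (∣⊥∣≡0 n)) z≤n)))
        (subst (λ z → z + suc k ≤ n) (sym ∣W∣) (subst (_≤ n) (+-comm (suc k) p) le))
  in hits-bound-missing V B uF hitV (≤-reflexive ∣V∣) ∣B∣ (meets-at B V x (x⊆ (lookup∘update x ⊥ true)) x∈V)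
       (¬true→false λ F∋B → true≢false (hitW B F∋B) B∩W)
  where
  disjoint : ∀ x → lookup W x ≡ false → ∀ y → lookup (⊥ [ x ]≔ true) y ≡ true → lookup W y ≡ true → Absurd
  disjoint x x∉W y y∈ y∈W with y ≟ᶠ x
  ... | yes refl = true≢false y∈W x∉W
  ... | no y≢x   = true≢false (∈-≔true ⊥ x y≢x y∈) (lookup-replicate y false)

-- The class of `u` has to hit two different sets that miss `u`, which costs it one set.
cover-bound-two : ∀ {j n p k} {F : Fam (suc n)} U → ∣ U ∣ ≡ suc j → suc k + p ≤ n →
  Unif (suc (suc k)) F → Hits F U → Avoid p F U →
  ∀ u V W → lookup U u ≡ true → lookup V u ≡ false → lookup W u ≡ false → V ≢ W → ∣ V ∣ ≡ p → ∣ W ∣ ≡ p →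
  Hits F V → Hits F W → suc (cnt F) ≤ m (suc n) (suc j) p (suc (suc k))
cover-bound-two {j} {F = F} U ∣U∣ le uF hit av u V W u∈U u∉V u∉W V≢W ∣V∣ ∣W∣ hitV hitW
  with view u U | view u V | view u W
... | at false U′ | _ | _ = true≢false u∈U (insertAt-lookup U′ u false)
... | _ | at true V′ | _ = true≢false (insertAt-lookup V′ u true) u∉V
... | _ | _ | at true W′ = true≢false (insertAt-lookup W′ u true) u∉W
... | at true U′ | at false V′ | at false W′ = ≤-trans (≤-reflexive (cong suc (cnt-split u F))) (+-mono-≤
  (hits-two-bound V′ W′ (V≢W ∘ cong (ins u false))
    (trans (sym (∣ins-false∣ u V′)) ∣V∣) (trans (sym (∣ins-false∣ u W′)) ∣W∣) le
    (unif-link u uF) (hits-link {F = F} u hitV) (hits-link {F = F} u hitW))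
  (cover-bound j U′ (∣ins-true∣⁻¹ u U′ ∣U∣) (unif-del u uF)
    (hits-del {F = F} u hit) (avoid-del {F = F} u av)))

-- The class of `u` has to hit a set smaller than `cover-bound` allows for, and `h-gap₁` measures
-- the difference.
cover-bound-small : ∀ {j n p k} {F : Fam (suc n)} U → ∣ U ∣ ≡ suc j → p + suc k ≤ n →
  Unif (suc (suc k)) F → Hits F U → Avoid (suc p) F U →
  ∀ u V → lookup U u ≡ true → lookup V u ≡ false → ∣ V ∣ ≤ p → Hits F V →
  suc (cnt F) ≤ m (suc n) (suc j) (suc p) (suc (suc k))
cover-bound-small {j} {n} {p} {k} {F} U ∣U∣ le uF hit av u V u∈U u∉V V≤p hitV with view u U | view u V
... | at false U′ | _ = true≢false u∈U (insertAt-lookup U′ u false)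
... | _ | at true V′ = true≢false (insertAt-lookup V′ u true) u∉V
... | at true U′ | at false V′ = ≤-trans (≤-reflexive (cong suc (cnt-split u F))) (+-mono-≤
  (≤-trans (s≤s (hits-bound p (suc k) V′ (unif-link u uF) (hits-link {F = F} u hitV) (≤-trans (∣≤ins∣ u false V′) V≤p)))
    (≤-trans (≤-reflexive (+-comm 1 _)) (h-gap₁ k (≤-refl {suc p}) le)))
  (cover-bound j U′ (∣ins-true∣⁻¹ u U′ ∣U∣) (unif-del u uF)
    (hits-del {F = F} u hit) (avoid-del {F = F} u av)))

-- Once the sets through `z` are split off, `V` has lost `z` and is small enough for
-- `cover-bound-small`.
cover-bound-meeting : ∀ {j n p k} {F : Fam (suc (suc n))} U → ∣ U ∣ ≡ suc (suc j) → p + suc k ≤ n →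
  Unif (suc (suc k)) F → Hits F U → Avoid (suc p) F U →
  ∀ z u V → lookup U z ≡ true → lookup V z ≡ true → lookup U u ≡ true → lookup V u ≡ false → ∣ V ∣ ≤ suc p → Hits F V →
  suc (cnt F) ≤ m (suc (suc n)) (suc (suc j)) (suc p) (suc (suc k))
cover-bound-meeting {F = F} U ∣U∣ le uF hit av z u V z∈U z∈V u∈U u∉V V≤p hitV with view z U | view z V
... | at false U′ | _ = true≢false z∈U (insertAt-lookup U′ z false)
... | _ | at false V′ = true≢false z∈V (insertAt-lookup V′ z false)
... | at true U′ | at true V′ = ≤-trans (≤-reflexive (trans (cong suc (cnt-split z F)) (sym (+-suc _ _)))) (+-mono-≤
  (avoid-link-bound z uF av)
  (cover-bound-small U′ (∣ins-true∣⁻¹ z U′ ∣U∣) le (unif-del z uF)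
    (hits-del {F = F} z hit) (avoid-del {F = F} z av)
    u′ V′ (trans (sym (at-u U′ true)) u∈U) (trans (sym (at-u V′ true)) u∉V)
    (≤-pred (≤-trans (≤-reflexive (sym (∣ins-true∣ z V′))) V≤p)) (hits-del {F = F} z hitV)))
  where
  z≢u : z ≢ u
  z≢u refl = true≢false (insertAt-lookup V′ z true) u∉V
  u′ = punchOut z≢u
  at-u : ∀ A b → lookup (ins z b A) u ≡ lookup A u′
  at-u A b = trans (cong (lookup (ins z b A)) (sym (punchIn-punchOut z≢u))) (insertAt-punchIn A z b u′)

-- Pairing F(u) with G(ū) and F(ū) with G(u), for u ∈ U, turns the claim into the same one for U ∖ {u}.
relative-bound : ∀ j {n k p} {F G : Fam n} U → j < k → j < p → k + suc j ≤ n →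
  Unif k F → Unif j G → Cross F G → G ∋ U → Avoid p F U → (suc j < k ⊎ NE F) →
  cnt F + cnt G ≤ suc (m n j p k) × (3 ≤ k → 2 ≤ cnt G → cnt F + cnt G ≤ m n j p k)
relative-bound zero {n} {k} {p} {F} {G} U j<k j<p le uF uG c G∋U av _
  rewrite cnt-empty (hits-empty {F = F} U (uG U G∋U) (λ A q → c A U q G∋U)) =
  unif-bound 0 uG , λ _ 2≤G → contradiction (unif-bound 0 uG) (<⇒≱ 2≤G)
relative-bound (suc j) {suc N} {suc k} {p} {F} {G} U (s≤s j<k) j<p (s≤s le) uF uG c G∋U av cond =
  go (choose cond)
  where
  -- If k = j + 1, then F(u) and G(ū) have the same uniformity; `u` is then taken from a member of F
  -- so that F(u) is nonempty.
  choose : (suc (suc j) < suc k ⊎ NE F) → ∃ λ u → lookup U u ≡ true × (k ≡ suc j → NE (link u F))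
  choose (inj₁ (s≤s lt)) = let u , u∈ = element U (uG U G∋U) in u , u∈ , λ e → contradiction (sym e) (<⇒≢ lt)
  choose (inj₂ (A , F∋A)) = let u , u∈A , u∈U = point A U (c A U F∋A G∋U) in u , u∈U , λ _ → NE-link {F = F} u A F∋A u∈A
  le₁ : suc k + suc j ≤ N
  le₁ = ≤-trans (≤-reflexive (sym (+-suc k (suc j)))) le
  le₂ : suc j + suc k ≤ N
  le₂ = subst (_≤ N) (+-comm (suc k) (suc j)) le₁
  gap₁ : ∀ {k} → suc j ≤ k → suc j + suc k ≤ N → suc (h N (suc j) k) ≤ h N p k
  gap₁ {suc r} _ le = ≤-trans (≤-reflexive (+-comm 1 _)) (h-gap₁ r j<p (≤-trans (+-monoʳ-≤ (suc j) (n≤1+n _)) le))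
  gap₂ : ∀ {k} → 3 ≤ suc k → suc j + suc k ≤ N → suc (suc (h N (suc j) k)) ≤ h N p k
  gap₂ {suc (suc r)} _ le = ≤-trans (≤-reflexive (+-comm 2 _)) (h-gap₂ r j<p le)
  gap₂ {suc zero} (s≤s (s≤s ())) _
  gap₂ {zero} (s≤s ()) _
  go : (∃ λ u → lookup U u ≡ true × (k ≡ suc j → NE (link u F))) →
    cnt F + cnt G ≤ suc (h N p k + m N j p (suc k)) ×
    (3 ≤ suc k → 2 ≤ cnt G → cnt F + cnt G ≤ h N p k + m N j p (suc k))
  go (u , u∈U , neF) with view u U
  ... | at false U′ = true≢false u∈U (insertAt-lookup U′ u false)
  ... | at true U′ = weak , sharp
    where
    open ≤-Reasoning
    a = cnt (link u F) + cnt (del u G)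
    b = cnt (del u F) + cnt (link u G)
    IH : b ≤ suc (m N j p (suc k)) × (3 ≤ suc k → 2 ≤ cnt (link u G) → b ≤ m N j p (suc k))
    IH = relative-bound j U′ (m<n⇒m<1+n j<k) (<⇒≤ j<p) le₁ (unif-del u uF) (unif-link u uG) (cross-del-link u c)
      G∋U (avoid-del {F = F} u av) (inj₁ (s≤s j<k))
    a-empty : ¬ NE (del u G) → a ≤ h N p k
    a-empty ¬G rewrite cnt-empty ¬G | +-identityʳ (cnt (link u F)) = avoid-link-bound u uF av
    a-full : NE (del u G) → a ≤ suc (h N (suc j) k)
    a-full neG = cross-bound-NE N j<k (≤-trans (n≤1+n _) le₁) (unif-link u uF) (unif-del u uG) (cross-link-del u c) neG neF
    a-weak : Dec (NE (del u G)) → a ≤ h N p k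
    a-weak (no ¬G)   = a-empty ¬G
    a-weak (yes neG) = ≤-trans (a-full neG) (gap₁ j<k le₂)
    weak : cnt F + cnt G ≤ suc (h N p k + m N j p (suc k))
    weak = begin
      cnt F + cnt G                       ≡⟨ cnt-cross-split u F G ⟩
      a + b                               ≤⟨ +-mono-≤ (a-weak (NE? (del u G))) (proj₁ IH) ⟩
      h N p k + suc (m N j p (suc k))     ≡⟨ +-suc _ _ ⟩
      suc (h N p k + m N j p (suc k)) ∎
    sharp : 3 ≤ suc k → 2 ≤ cnt G → cnt F + cnt G ≤ h N p k + m N j p (suc k)
    sharp 3≤k 2≤G = ≤-trans (≤-reflexive (cnt-cross-split u F G)) (ab (NE? (del u G)))
      where
      -- If all members of G contain `u`, they all pass to G(u) and the saving comes from the
      -- induction hypothesis. Otherwise `gap₂` leaves a spare set in the pair of F(u) and G(ū).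
      ab : Dec (NE (del u G)) → a + b ≤ h N p k + m N j p (suc k)
      ab (no ¬G) = +-mono-≤ (a-empty ¬G) (proj₂ IH 3≤k
        (≤-trans 2≤G (≤-reflexive (cnt-link u G ¬G))))
      ab (yes neG) = ≤-pred (begin
        suc a + b                          ≤⟨ +-mono-≤ (≤-trans (s≤s (a-full neG)) (gap₂ 3≤k le₂)) (proj₁ IH) ⟩
        h N p k + suc (m N j p (suc k))    ≡⟨ +-suc _ _ ⟩
        suc (h N p k + m N j p (suc k)) ∎)

-- Unequal uniformities

lookup-ins : ∀ {n} {x y : Fin (suc n)} (x≢y : x ≢ y) b A → lookup (ins x b A) y ≡ lookup A (punchOut x≢y)
lookup-ins {x = x} x≢y b A =
  trans (cong (lookup (ins x b A)) (sym (punchIn-punchOut x≢y))) (insertAt-punchIn A x b (punchOut x≢y))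

separate : ∀ {n} (A : Subset n) {x y} → lookup A x ≡ true → lookup A y ≡ false → x ≢ y
separate A p q refl = true≢false p q

points : ∀ {n} → List (Fin n) → Subset n
points []       = ⊥
points (x ∷ xs) = points xs [ x ]≔ true

points⁻ : ∀ {n} xs {y : Fin n} → lookup (points xs) y ≡ true → y ∈L xs
points⁻ []       {y} p = true≢false p (lookup-replicate y false)
points⁻ (x ∷ xs) {y} p with y ≟ᶠ x
... | yes refl = here refl
... | no y≢x   = there (points⁻ xs (∈-≔true (points xs) x y≢x p))

points⁺ : ∀ {n} xs {y : Fin n} → y ∈L xs → lookup (points xs) y ≡ true
points⁺ (x ∷ xs) {y} y∈ with y ≟ᶠ x
points⁺ (x ∷ xs) y∈           | yes refl = lookup∘update x (points xs) true
points⁺ (x ∷ xs) (here e)     | no y≢x   = contradiction e y≢x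
points⁺ (x ∷ xs) (there y∈)   | no y≢x   = trans (lookup∘update′ y≢x (points xs) true) (points⁺ xs y∈)

∣points∣ : ∀ {n} (xs : List (Fin n)) → ∣ points xs ∣ ≤ length xs
∣points∣ {n} []   = ≤-reflexive (∣⊥∣≡0 n)
∣points∣ (x ∷ xs) = ≤-trans (∣[]≔true∣ (points xs) x) (s≤s (∣points∣ xs))

through : ∀ {n} k (xs ys : List (Fin n)) → All (λ x → All (x ≢_) ys) xs → length xs ≤ k → length ys + k ≤ n →
  ∃ λ B → ∣ B ∣ ≡ k × All (λ x → lookup B x ≡ true) xs × All (λ y → lookup B y ≡ false) ys
through k xs ys xs#ys xs≤k le =
  let B , ∣B∣ , xs⊆B , B∩ys = between k (points xs) (points ys)
        (¬true→false λ t → let z , z∈ , z∈′ = point (points xs) (points ys) t in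
          All.lookup (All.lookup xs#ys (points⁻ xs z∈)) (points⁻ ys z∈′) refl)
        (≤-trans (∣points∣ xs) xs≤k) (≤-trans (+-monoˡ-≤ k (∣points∣ ys)) le)
  in B , ∣B∣ , All.tabulate (λ x∈ → xs⊆B (points⁺ xs x∈)) ,
     All.tabulate (λ {y} y∈ → ¬true→false λ y∈B → true≢false (meets-at B (points ys) y y∈B (points⁺ ys y∈)) B∩ys)

two-link : ∀ {n} x (F : Fam (suc n)) {A B} → A ≢ B → F ∋ A → F ∋ B →
  lookup A x ≡ true → lookup B x ≡ true → 2 ≤ cnt (link x F)
two-link x F {A} {B} A≢B p q a b with view x A | view x B
... | at false A′ | _ = true≢false a (insertAt-lookup A′ x false)
... | _ | at false B′ = true≢false b (insertAt-lookup B′ x false)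
... | at true A′ | at true B′ = cnt≥2 (link x F) (A≢B ∘ cong (ins x true)) p q

two-del : ∀ {n} x (F : Fam (suc n)) {A B} → A ≢ B → F ∋ A → F ∋ B →
  lookup A x ≡ false → lookup B x ≡ false → 2 ≤ cnt (del x F)
two-del x F {A} {B} A≢B p q a b with view x A | view x B
... | at true A′ | _ = true≢false (insertAt-lookup A′ x true) a
... | _ | at true B′ = true≢false (insertAt-lookup B′ x true) b
... | at false A′ | at false B′ = cnt≥2 (del x F) (A≢B ∘ cong (ins x false)) p q

ins-injective : ∀ {n} x b {A B : Subset n} → ins x b A ≡ ins x b B → A ≡ B
ins-injective x b {A} {B} e =
  trans (sym (removeAt-insertAt A x b)) (trans (cong (λ z → removeAt z x) e) (removeAt-insertAt B x b))

link-unique : ∀ {n} x (F : Fam (suc n)) {A B} → cnt (link x F) ≤ 1 →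
  F ∋ A → F ∋ B → lookup A x ≡ true → lookup B x ≡ true → A ≡ B
link-unique x F {A} {B} l p q a b with A ≟ˢ B
... | yes e = e
... | no ne = contradiction (two-link x F ne p q a b) (<⇒≱ (s≤s l))

del-unique : ∀ {n} x (F : Fam (suc n)) {A B} → cnt (del x F) ≤ 1 →
  F ∋ A → F ∋ B → lookup A x ≡ false → lookup B x ≡ false → A ≡ B
del-unique x F {A} {B} l p q a b with A ≟ˢ B
... | yes e = e
... | no ne = contradiction (two-del x F ne p q a b) (<⇒≱ (s≤s l))

-- Largest partners of a family

Closed : ∀ {n} → ℕ → Fam n → Fam n → Set
Closed k F G = ∀ A → ∣ A ∣ ≡ k → Hits G A → F ∋ A

cov? : ∀ {n} k (G : Fam n) A → Dec (∣ A ∣ ≡ k × ¬ ∃ λ B → G ∋ B × meets B A ≡ false)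
cov? k G A = (∣ A ∣ ≟ k) ×-dec ¬? (anySubset? λ B → (G B ≟ᵇ true) ×-dec (meets B A ≟ᵇ false))

-- The largest k-uniform family that is cross-intersecting with G.
cov : ∀ {n} → ℕ → Fam n → Fam n
cov k G A = ⌊ cov? k G A ⌋

cov⁻ : ∀ {n} k (G : Fam n) A → cov k G ∋ A → ∣ A ∣ ≡ k × Hits G A
cov⁻ k G A p with cov? k G A
... | yes (e , ∄) = e , λ B q → ¬false→true λ f → ∄ (B , q , f)

cov⁺ : ∀ {n} k (G : Fam n) → Closed k (cov k G) G
cov⁺ k G A e hit with cov? k G A
... | yes _ = refl
... | no ne = contradiction (e , λ { (B , q , f) → true≢false (hit B q) f }) ne

NT→avoid : ∀ {n ℓ} {F G : Fam n} U → NT G → Unif ℓ G → Cross F G → Avoid ℓ F U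
NT→avoid U nt uG c x _ = let V , q , x∉ = nt x in V , x∉ , ≤-reflexive (uG V q) , λ A p → c A V p q

NT→NE : ∀ {n} {F : Fam (suc n)} → NT F → NE F
NT→NE nt = let A , p , _ = nt zero in A , p

-- `cover-bound` along any member of G bounds F by `m`, and G itself contributes at most two.
few-bound : ∀ {n k ℓ} {F G : Fam (suc n)} → Unif k F → Unif ℓ G → Cross F G → NT G → cnt G ≤ 2 →
  cnt F + cnt G ≤ 2 + m (suc n) ℓ ℓ k
few-bound {n} {k} {ℓ} uF uG c nt G≤2 = let U , q = NT→NE nt in
  ≤-trans (+-mono-≤ (cover-bound ℓ U (uG U q) uF (λ A p → c A U p q) (NT→avoid U nt uG c)) G≤2)
    (≤-reflexive (+-comm (m (suc n) ℓ ℓ k) 2))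

module _ {N k l} {F G : Fam (suc N)} (l≤k : l ≤ k) (le : suc k + suc l ≤ N)
  (uF : Unif (suc k) F) (uG : Unif (suc l) G) (c : Cross F G) (ntG : NT G) where

  -- The critical pair, F(u) with G(ū), is left as a hypothesis; `relative-bound` treats the other
  -- pair along a member of G(u). Each pair contributes one of the two excess sets, and the second
  -- pair loses its own once G(u) has two members.
  pivot : ∀ u → cnt (link u F) + cnt (del u G) ≤ suc (h N (suc l) k) → NE (link u G) → (l < k ⊎ NE (del u F)) →
    cnt F + cnt G ≤ 2 + m (suc N) (suc l) (suc l) (suc k) ×
    (3 ≤ suc k → 2 ≤ cnt (link u G) → cnt F + cnt G ≤ 1 + m (suc N) (suc l) (suc l) (suc k))
  pivot u a≤ (U , q) cond =
    ≤-trans (combine (proj₁ rb)) (≤-reflexive (cong suc (+-suc (h N (suc l) k) _))) , λ 3≤k 2≤ → combine (proj₂ rb 3≤k 2≤)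
    where
    rb = relative-bound l U (s≤s l≤k) ≤-refl le (unif-del u uF) (unif-link u uG) (cross-del-link u c)
      q (avoid-del {F = F} u (NT→avoid (ins u true U) ntG uG c))
      (Sum.map₁ s≤s cond)
    combine : ∀ {t} → cnt (del u F) + cnt (link u G) ≤ t → cnt F + cnt G ≤ suc (h N (suc l) k + t)
    combine b≤ = ≤-trans (≤-reflexive (cnt-cross-split u F G)) (+-mono-≤ a≤ b≤)

module _ {N k l} {F G : Fam (suc N)} (l<k : suc (suc l) ≤ k) (le : suc k + suc (suc l) ≤ N)
  (uF : Unif (suc k) F) (uG : Unif (suc (suc l)) G) (c : Cross F G) (ntG : NT G) (neF : NE F)
  (closed : Closed (suc k) F G) where

  -- As ℓ < k, members of F(u) are still at least as large as those of G(ū), so the classical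
  -- estimate settles the critical pair.
  pivot-unequal : ∀ u → NE (link u F) → NE (link u G) → 2 ≤ cnt (link u G) →
    cnt F + cnt G ≤ 1 + m (suc N) (suc (suc l)) (suc (suc l)) (suc k)
  pivot-unequal u neF′ neG′ = proj₂ (pivot (<⇒≤ l<k) le uF uG c ntG u
    (cross-bound-NE N l<k (≤-trans (n≤1+n _) le) (unif-link u uF) (unif-del u uG) (cross-link-del u c)
      (let V , q , u∉V = ntG u in NE-del {F = G} u V q u∉V) (λ _ → neF′))
    neG′ (inj₁ l<k)) (s≤s (≤-trans (s≤s (s≤s z≤n)) l<k))

  -- The pivot `u` lies in a member of F and in some U of G. If `U` is the only member of G through
  -- `u`, a second element `y` of `U` is examined: either `y` is a good pivot, or two members of G
  -- miss both `u` and `y`.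
  sharp-unequal : 3 ≤ cnt G → cnt F + cnt G ≤ 1 + m (suc N) (suc (suc l)) (suc (suc l)) (suc k)
  sharp-unequal 3≤G =
    let A , F∋A = neF
        U , G∋U = NT→NE ntG
        u , u∈A , u∈U = point A U (c A U F∋A G∋U)
    in step u (NE-link {F = F} u A F∋A u∈A) U G∋U u∈U
    where
    step : ∀ u → NE (link u F) → ∀ U → G ∋ U → lookup U u ≡ true →
      cnt F + cnt G ≤ 1 + m (suc N) (suc (suc l)) (suc (suc l)) (suc k)
    step u neF′ U G∋U u∈U with 2 ≤? cnt (link u G) | view u U
    ... | _ | at false U′ = true≢false u∈U (insertAt-lookup U′ u false)
    ... | yes 2≤ | _ = pivot-unequal u neF′ (NE-link {F = G} u U G∋U u∈U) 2≤
    ... | no 2≰ | at true U′ = lone (element U′ ∣U′∣)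
      where
      ∣U′∣ : ∣ U′ ∣ ≡ suc l
      ∣U′∣ = ∣ins-true∣⁻¹ u U′ (uG _ G∋U)
      link≤1 : cnt (link u G) ≤ 1
      link≤1 = ≤-pred (≰⇒> 2≰)
      lone : (∃ λ v → lookup U′ v ≡ true) → cnt F + cnt G ≤ 1 + m (suc N) (suc (suc l)) (suc (suc l)) (suc k)
      lone (v , v∈U′) with 2 ≤? cnt (del y G)
        where y = punchIn u v
      -- At most one member `V` of G misses `y`, so at least two contain it. A set through `y` and
      -- an element of `V` hits all of G and, F being closed, provides a member of F through `y`.
      ... | no 2≰′ = pivot-unequal y (NE-link {F = F} y B (closed B ∣B∣ covers) y∈B) (NE-link {F = G} y _ G∋U y∈U) 2≤′
        where
        y = punchIn u v
        y∈U = trans (insertAt-punchIn U′ u true v) v∈U′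
        del≤1 : cnt (del y G) ≤ 1
        del≤1 = ≤-pred (≰⇒> 2≰′)
        2≤′ : 2 ≤ cnt (link y G)
        2≤′ = +-cancelʳ-≤ 1 2 _ (≤-trans (≤-trans 3≤G (≤-reflexive (cnt-split y G))) (+-monoʳ-≤ _ del≤1))
        V = proj₁ (ntG y)
        G∋V = proj₁ (proj₂ (ntG y))
        y∉V = proj₂ (proj₂ (ntG y))
        w = element V (uG V G∋V)
        ex = through (suc k) (y ∷ proj₁ w ∷ []) [] ([] ∷ [] ∷ []) (s≤s (≤-trans (s≤s z≤n) l<k))
          (≤-trans (m≤m+n (suc k) _) (m≤n⇒m≤1+n le))
        B = proj₁ ex
        ∣B∣ = proj₁ (proj₂ ex)
        y∈B : lookup B y ≡ true
        y∈B = All.head (proj₁ (proj₂ (proj₂ ex)))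
        covers : Hits G B
        covers Z G∋Z with lookup Z y in e
        ... | true = meets-at Z B y e y∈B
        ... | false with del-unique y G del≤1 G∋Z G∋V e y∉V
        ... | refl = meets-at Z B (proj₁ w) (proj₂ w) (All.head (All.tail (proj₁ (proj₂ (proj₂ ex)))))
      -- Two members of G miss `y`. They differ from `U`, hence miss `u` as well and survive in
      -- G(ū), where `cover-bound-two` at `y` saves one set of F(ū).
      ... | yes 2≤′ with two-members (del (punchIn u v) G) 2≤′
      ... | V₀ , W₀ , V₀≢W₀ , G∋V , G∋W = two (view u V) (view u W) G∋V G∋W (u∉ V G∋V y∉V) (u∉ W G∋W y∉W) V≢W y∉V y∉W
        where
        y = punchIn u v
        V = ins y false V₀
        W = ins y false W₀
        V≢W : V ≢ W
        V≢W = V₀≢W₀ ∘ ins-injective y false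
        y∈U = trans (insertAt-punchIn U′ u true v) v∈U′
        y∉V = insertAt-lookup V₀ y false
        y∉W = insertAt-lookup W₀ y false
        u∉ : ∀ Z → G ∋ Z → lookup Z y ≡ false → lookup Z u ≡ false
        u∉ Z G∋Z y∉Z = ¬true→false λ u∈Z →
          true≢false (subst (λ X → lookup X y ≡ true)
            (link-unique u G link≤1 G∋U G∋Z (insertAt-lookup U′ u true) u∈Z) y∈U) y∉Z
        two : ∀ {V W} → View u V → View u W → G ∋ V → G ∋ W → lookup V u ≡ false → lookup W u ≡ false → V ≢ W →
          lookup V y ≡ false → lookup W y ≡ false →
          cnt F + cnt G ≤ 1 + m (suc N) (suc (suc l)) (suc (suc l)) (suc k)
        two (at true V′) _ _ _ u∉V _ _ _ _ = true≢false (insertAt-lookup V′ u true) u∉V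
        two _ (at true W′) _ _ _ u∉W _ _ _ = true≢false (insertAt-lookup W′ u true) u∉W
        two (at false V′) (at false W′) G∋V G∋W _ _ V≢W y∉V y∉W = begin
          cnt F + cnt G
            ≡⟨ cnt-cross-split u F G ⟩
          (cnt (link u F) + cnt (del u G)) + (cnt (del u F) + cnt (link u G))
            ≤⟨ +-mono-≤ H1 (≤-trans (+-monoʳ-≤ (cnt (del u F)) link≤1) (≤-trans (≤-reflexive (+-comm _ 1))
                 (sharp-del le l<k (unif-del u uF)))) ⟩
          suc (h N (suc (suc l)) k) + m N (suc l) (suc (suc l)) (suc k) ∎
          where
          open ≤-Reasoning
          H1 = cross-bound-NE N l<k (≤-trans (n≤1+n _) le) (unif-link u uF) (unif-del u uG) (cross-link-del u c)
            (V′ , G∋V) (λ _ → neF′)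
          hit : ∀ {Z} → G ∋ ins u false Z → Hits (del u F) Z
          hit G∋Z = hits-del {F = F} u (λ A p → c A _ p G∋Z)
          sharp-del : ∀ {k} → suc k + suc (suc l) ≤ N → suc (suc l) ≤ k → Unif (suc k) (del u F) →
            suc (cnt (del u F)) ≤ m N (suc l) (suc (suc l)) (suc k)
          sharp-del {suc k} (s≤s le) _ uF′ = cover-bound-two U′ ∣U′∣ le uF′ (hits-del {F = F} u (λ A p → c A _ p G∋U))
            (avoid-del {F = F} u (NT→avoid (ins u true U′) ntG uG c)) v V′ W′ v∈U′
            (trans (sym (insertAt-punchIn V′ u false v)) y∉V) (trans (sym (insertAt-punchIn W′ u false v)) y∉W)
            (V≢W ∘ cong (ins u false))
            (trans (sym (∣ins-false∣ u V′)) (uG _ G∋V)) (trans (sym (∣ins-false∣ u W′)) (uG _ G∋W))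
            (hit G∋V) (hit G∋W)

-- Equal uniformities

-- A transversal {x, y}, where `x` and `y` may coincide.
PairCover : ∀ {n} → Fam n → Fin n → Fin n → Set
PairCover G x y = ∀ B → G ∋ B → lookup B x ≡ true ⊎ lookup B y ≡ true

Splits : ∀ {n} → Fam n → Fin n → Fin n → Set
Splits F x y = ∃ λ A → F ∋ A × lookup A x ≡ true × lookup A y ≡ false

module _ {M k} {F G : Fam (suc (suc M))} (le : suc (suc k) + suc (suc k) ≤ suc M)
  (uF : Unif (suc (suc k)) F) (uG : Unif (suc (suc k)) G) (c : Cross F G) (ntF : NT F) (ntG : NT G) where

  private
    μ = m (suc (suc M)) (suc (suc k)) (suc (suc k)) (suc (suc k))

  -- All members of G(x̄) contain `y`, so the critical pair can be split again at `y`. The sets of F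
  -- through `x` but not `y` are then paired with sets of the same size, both families are nonempty,
  -- and the classical estimate applies.
  pair-pivot : ∀ x y → PairCover G x y → Splits F x y →
    cnt F + cnt G ≤ 2 + μ × (3 ≤ suc (suc k) → 2 ≤ cnt (link x G) → cnt F + cnt G ≤ 1 + μ)
  pair-pivot x y cover (A , F∋A , x∈A , y∉A) =
    pivot ≤-refl le uF uG c ntG x H1
      (let V , q , y∉V = ntG y in NE-link {F = G} x V q (Sum.[ (λ e → e) , (λ e → true≢false e y∉V) ] (cover V q)))
      (inj₂ (let B , q , x∉B = ntF x in NE-del {F = F} x B q x∉B))
    where
    x≢y : x ≢ y
    x≢y = separate A x∈A y∉A
    y′ = punchOut x≢y
    ¬dd : ¬ NE (del y′ (del x G))
    ¬dd (Z , q) with cover _ q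
    ... | inj₁ e = true≢false e (insertAt-lookup (ins y′ false Z) x false)
    ... | inj₂ e = true≢false e (trans (lookup-ins x≢y false (ins y′ false Z)) (insertAt-lookup Z y′ false))
    ne-ld : ∀ {A} → View x A → F ∋ A → lookup A x ≡ true → lookup A y ≡ false → NE (del y′ (link x F))
    ne-ld (at false A′) _ x∈ _ = true≢false x∈ (insertAt-lookup A′ x false)
    ne-ld (at true A′) p _ y∉ = NE-del {F = link x F} y′ A′ p (trans (sym (lookup-ins x≢y true A′)) y∉)
    ne-dl : ∀ {V} → View x V → G ∋ V → lookup V x ≡ false → NE (link y′ (del x G))
    ne-dl (at true V′) _ x∉ = true≢false (insertAt-lookup V′ x true) x∉
    ne-dl (at false V′) q x∉ with cover _ q
    ... | inj₁ e = true≢false e x∉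
    ... | inj₂ e = NE-link {F = del x G} y′ V′ q (trans (sym (lookup-ins x≢y false V′)) e)
    le′ : suc k + suc k ≤ M
    le′ = ≤-pred (≤-trans (s≤s (≤-trans (n≤1+n _) (≤-reflexive (sym (+-suc (suc k) (suc k)))))) le)
    H1 : cnt (link x F) + cnt (del x G) ≤ suc (bin M k + h M (suc k) (suc k))
    H1 = begin
      cnt (link x F) + cnt (del x G)
        ≡⟨ cong₂ _+_ (cnt-split y′ (link x F)) (cnt-link y′ (del x G) ¬dd) ⟩
      (cnt (link y′ (link x F)) + cnt (del y′ (link x F))) + cnt (link y′ (del x G))
        ≡⟨ +-assoc (cnt (link y′ (link x F))) _ _ ⟩
      cnt (link y′ (link x F)) + (cnt (del y′ (link x F)) + cnt (link y′ (del x G)))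
        ≤⟨ +-mono-≤ (unif-bound k (unif-link y′ (unif-link x uF)))
             (cross-bound-NE M ≤-refl le′ (unif-del y′ (unif-link x uF)) (unif-link y′ (unif-del x uG))
               (cross-del-link y′ (cross-link-del x c))
               (let V , q , x∉V = ntG x in ne-dl (view x V) q x∉V)
               (λ _ → ne-ld (view x A) F∋A x∈A y∉A)) ⟩
      bin M k + suc (h M (suc k) (suc k))
        ≡⟨ +-suc _ _ ⟩
      suc (bin M k + h M (suc k) (suc k)) ∎
      where open ≤-Reasoning

  -- Every member of G contains `x` or `y`, so one of them lies in two members and serves as pivot.
  -- If it is `y`, the only member `U` through `x` has a further element `b`, and a set through `y`
  -- and `b` that avoids `x` belongs to F by closedness, so `x` and `y` can be exchanged.
  sharp-pair : 3 ≤ suc (suc k) → 3 ≤ cnt G → Closed (suc (suc k)) F G →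
    ∀ x y → PairCover G x y → Splits F x y → cnt F + cnt G ≤ 1 + μ
  sharp-pair 3≤k 3≤G closed x y cover sp with 2 ≤? cnt (link x G) | 2 ≤? cnt (link y G)
  ... | yes 2≤ | _ = proj₂ (pair-pivot x y cover sp) 3≤k 2≤
  ... | no 2≰ | yes 2≤ =
    let U , G∋U , y∉U = ntG y
        x∈U = Sum.[ (λ e → e) , (λ e → true≢false e y∉U) ] (cover U G∋U)
    in other U G∋U y∉U x∈U (view x U)
    where
    other : ∀ U → G ∋ U → lookup U y ≡ false → lookup U x ≡ true → View x U → cnt F + cnt G ≤ 1 + μ
    other _ _ _ x∈U (at false U′) = true≢false x∈U (insertAt-lookup U′ x false)
    other U G∋U y∉U x∈U (at true U′) =
      let b′ , b′∈ = element U′ (∣ins-true∣⁻¹ x U′ (uG U G∋U))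
          b = punchIn x b′
          b∈U = trans (insertAt-punchIn U′ x true b′) b′∈
          B , ∣B∣ , yb∈B , x∉B = through (suc (suc k)) (y ∷ b ∷ []) (x ∷ [])
            ((separate U x∈U y∉U ∘ sym ∷ []) ∷ (punchInᵢ≢i x b′ ∷ []) ∷ []) (s≤s (s≤s z≤n))
            (s≤s (≤-trans (m≤m+n (suc (suc k)) _) le))
      in proj₂ (pair-pivot y x (λ Z q → Sum.swap (cover Z q))
           (B , closed B ∣B∣ (λ Z G∋Z →
             covers b B b∈U (All.head (All.tail yb∈B)) (All.head yb∈B) Z G∋Z (cover Z G∋Z)) ,
            All.head yb∈B , All.head x∉B)) 3≤k 2≤
      where
      covers : ∀ b B → lookup U b ≡ true → lookup B b ≡ true → lookup B y ≡ true →
        ∀ Z → G ∋ Z → lookup Z x ≡ true ⊎ lookup Z y ≡ true → meets Z B ≡ true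
      covers b B b∈U b∈B y∈B Z G∋Z (inj₂ y∈Z) = meets-at Z B y y∈Z y∈B
      covers b B b∈U b∈B y∈B Z G∋Z (inj₁ x∈Z)
        with link-unique x G (≤-pred (≰⇒> 2≰)) G∋U G∋Z x∈U x∈Z
      ... | e = meets-at Z B b (subst (λ X → lookup X b ≡ true) e b∈U) b∈B
  ... | no 2≰ | no 2≰′ = contradiction
    (≤-trans 3≤G (≤-trans (≤-reflexive (cnt-split x G)) (+-mono-≤ (≤-pred (≰⇒> 2≰)) del≤1))) λ { (s≤s (s≤s ())) }
    where
    del≤1 : cnt (del x G) ≤ 1
    del≤1 with 2 ≤? cnt (del x G)
    ... | no ≰ = ≤-pred (≰⇒> ≰)
    ... | yes 2≤ with two-members (del x G) 2≤
    ... | P , Q , P≢Q , G∋P , G∋Q =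
      contradiction (two-link y G (P≢Q ∘ ins-injective x false) G∋P G∋Q (y∈ P G∋P) (y∈ Q G∋Q)) 2≰′
      where
      y∈ : ∀ P → G ∋ ins x false P → lookup (ins x false P) y ≡ true
      y∈ P q = Sum.[ (λ e → true≢false e (insertAt-lookup P x false)) , (λ e → e) ] (cover _ q)

sole-element : ∀ {n} (A : Subset n) {x y} → ∣ A ∣ ≡ 1 → lookup A x ≡ true → lookup A y ≡ true → x ≡ y
sole-element A {x} {y} ∣A∣ x∈ y∈ with x ≟ᶠ y
... | yes e = e
sole-element {suc n} A {x} {y} ∣A∣ x∈ y∈ | no x≢y with view x A
... | at false A′ = true≢false x∈ (insertAt-lookup A′ x false)
... | at true A′  = true≢false (trans (sym (lookup-ins x≢y true A′)) y∈)
  (∣A∣≡0→∉ A′ (∣ins-true∣⁻¹ x A′ ∣A∣) _)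

pair-elements : ∀ {n} (A : Subset n) {x y z} → ∣ A ∣ ≡ 2 → lookup A x ≡ true → lookup A y ≡ true → x ≢ y →
  lookup A z ≡ true → z ≡ x ⊎ z ≡ y
pair-elements {suc n} A {x} {y} {z} ∣A∣ x∈ y∈ x≢y z∈ with x ≟ᶠ z | view x A
... | yes e | _ = inj₁ (sym e)
... | _ | at false A′ = true≢false x∈ (insertAt-lookup A′ x false)
... | no x≢z | at true A′ = inj₂ (trans (sym (punchIn-punchOut x≢z)) (trans (cong (punchIn x)
  (sole-element A′ (∣ins-true∣⁻¹ x A′ ∣A∣)
    (trans (sym (lookup-ins x≢z true A′)) z∈) (trans (sym (lookup-ins x≢y true A′)) y∈))) (punchIn-punchOut x≢y)))

-- Three edges of F all meet one edge of G, so two of them, `P` and `Q`, share a vertex. The ends of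
-- `P` form a transversal of G, and `Q` contains exactly one of them.
graph-pair : ∀ {n} {F G : Fam (suc n)} → Unif 2 F → Unif 2 G → Cross F G → NE G → 3 ≤ cnt F →
  ∃₂ λ x y → PairCover G x y × Splits F x y
graph-pair {n} {F} {G} uF uG c (Z , G∋Z) 3≤F = go (element Z (uG Z G∋Z))
  where
  meeting : ∀ P Q x → F ∋ P → F ∋ Q → P ≢ Q → lookup P x ≡ true → lookup Q x ≡ true →
    ∃₂ λ x y → PairCover G x y × Splits F x y
  meeting P Q x F∋P F∋Q P≢Q x∈P x∈Q =
    let y , y∈P , y∉Q = difference P Q (≤-reflexive (trans (uF Q F∋Q) (sym (uF P F∋P)))) P≢Q
    in x , y , (λ B G∋B → let z , z∈P , z∈B = point P B (c P B F∋P G∋B) in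
         Sum.map (λ e → subst (λ i → lookup B i ≡ true) e z∈B) (λ e → subst (λ i → lookup B i ≡ true) e z∈B)
           (pair-elements P (uF P F∋P) x∈P y∈P (separate Q x∈Q y∉Q) z∈P)) ,
       Q , F∋Q , x∈Q , y∉Q
  go : (∃ λ u → lookup Z u ≡ true) → ∃₂ λ x y → PairCover G x y × Splits F x y
  go (u , u∈Z) with 2 ≤? cnt (link u F)
  ... | yes 2≤ = let P , Q , P≢Q , F∋P , F∋Q = two-members (link u F) 2≤ in
    meeting _ _ u F∋P F∋Q (P≢Q ∘ ins-injective u true) (insertAt-lookup P u true) (insertAt-lookup Q u true)
  ... | no 2≰ = rest (view u Z) G∋Z u∈Z
    where
    2≤ : 2 ≤ cnt (del u F)
    2≤ = +-cancelˡ-≤ 1 2 _ (≤-trans (≤-trans 3≤F (≤-reflexive (cnt-split u F))) (+-monoˡ-≤ _ (≤-pred (≰⇒> 2≰))))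
    rest : ∀ {Z} → View u Z → G ∋ Z → lookup Z u ≡ true → ∃₂ λ x y → PairCover G x y × Splits F x y
    rest (at false Z′) _ u∈Z = true≢false u∈Z (insertAt-lookup Z′ u false)
    rest (at true Z′) G∋Z _ =
      let P , Q , P≢Q , F∋P , F∋Q = two-members (del u F) 2≤
          hit = hits-del {F = F} u {V = Z′} (λ A p → c A _ p G∋Z)
          z , z∈P , z∈Z = point P Z′ (hit P F∋P)
          z′ , z′∈Q , z′∈Z = point Q Z′ (hit Q F∋Q)
          z′≡z = sole-element Z′ (∣ins-true∣⁻¹ u Z′ (uG _ G∋Z)) z′∈Z z∈Z
      in meeting _ _ (punchIn u z) F∋P F∋Q (P≢Q ∘ ins-injective u false)
           (trans (insertAt-punchIn P u false z) z∈P)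
           (trans (insertAt-punchIn Q u false z) (subst (λ i → lookup Q i ≡ true) z′≡z z′∈Q))

-- Elements in no two-element transversal

pairCover? : ∀ {n} (F : Fam n) x y → PairCover F x y ⊎ ∃ λ A → F ∋ A × lookup A x ≡ false × lookup A y ≡ false
pairCover? F x y with anySubset? (λ A → (F A ≟ᵇ true) ×-dec ((lookup A x ≟ᵇ false) ×-dec (lookup A y ≟ᵇ false)))
... | yes p = inj₂ p
... | no ∄  = inj₁ covered
  where
  covered : PairCover F x y
  covered A p with lookup A x in eˣ | lookup A y in eʸ
  ... | true  | _     = inj₁ refl
  ... | false | true  = inj₂ refl
  ... | false | false = contradiction (A , p , eˣ , eʸ) ∄

somePairCover? : ∀ {n} (F : Fam n) → (∃₂ λ x y → PairCover F x y) ⊎ (∀ x y → ¬ PairCover F x y)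
somePairCover? F with any? (λ x → any? (λ y → dec x y))
  where
  dec : ∀ x y → Dec (PairCover F x y)
  dec x y with pairCover? F x y
  ... | inj₁ p = yes p
  ... | inj₂ (A , p , x∉ , y∉) = no λ cover → Sum.[ (λ e → true≢false e x∉) , (λ e → true≢false e y∉) ] (cover A p)
... | yes (x , y , p) = inj₁ (x , y , p)
... | no ∄ = inj₂ λ x y p → ∄ (x , y , p)

-- As {w, z} is no transversal, some member misses both `w` and `z`.
del-NT : ∀ {n} {F : Fam (suc n)} w → (∀ z → ¬ PairCover F w z) → NT (del w F)
del-NT {F = F} w free z with pairCover? F w (punchIn w z)
... | inj₁ p = contradiction p (free _)
... | inj₂ (A , p , w∉ , z∉) = go (view w A) p w∉ z∉
  where
  go : ∀ {A} → View w A → F ∋ A → lookup A w ≡ false → lookup A (punchIn w z) ≡ false →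
    ∃ λ A′ → del w F ∋ A′ × lookup A′ z ≡ false
  go (at true A′) _ w∉ _  = true≢false (insertAt-lookup A′ w true) w∉
  go (at false A′) p _ z∉ = A′ , p , trans (sym (insertAt-punchIn A′ w false z)) z∉

-- A member `A` of F missing `x` misses `y` too, since F does not split {x, y}. Any `w` outside `A`,
-- `x` and `y` works: given a transversal {w, z} of F or of G, closedness puts into F a k-set that
-- misses `w` and `z`, respectively one that contains just one of `x` and `y`.
isolate : ∀ {n k} {F G : Fam n} → 3 ≤ k → k + k < n → Unif k F → NT F → NT G → Closed k F G →
  (∀ x y → PairCover G x y → ¬ Splits F x y) → ∀ x y → PairCover G x y →
  ∃ λ w → (∀ z → ¬ PairCover F w z) × (∀ z → ¬ PairCover G w z)
isolate {n} {k} {F} {G} 3≤k k+k<n uF ntF ntG closed unsplit x y cover =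
  let A , F∋A , x∉A = ntF x
      y∉A = ¬true→false λ y∈A → unsplit y x (λ B q → Sum.swap (cover B q)) (A , F∋A , y∈A , x∉A)
      w , w∉A , w∉xy = outside-both A (points (x ∷ y ∷ []))
        (≤-<-trans (+-mono-≤ (≤-reflexive (uF A F∋A)) (∣points∣ (x ∷ y ∷ [])))
          (≤-<-trans (+-monoʳ-≤ k (≤-trans (n≤1+n 2) 3≤k)) k+k<n))
      w≢x = λ e → true≢false (points⁺ (x ∷ y ∷ []) (here e)) w∉xy
      w≢y = λ e → true≢false (points⁺ (x ∷ y ∷ []) (there (here e))) w∉xy
  in w , noF A F∋A x∉A y∉A w w∉A w≢x w≢y , noG w w≢x w≢y
  where
  x≢y : x ≢ y
  x≢y refl = let B , q , x∉B = ntG x in true≢false (Sum.[ (λ e → e) , (λ e → e) ] (cover B q)) x∉B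
  3+k≤n : 3 + k ≤ n
  3+k≤n = ≤-trans (+-monoˡ-≤ k 3≤k) (<⇒≤ k+k<n)
  covers : ∀ {u v} B → PairCover G u v → lookup B u ≡ true → lookup B v ≡ true → Hits G B
  covers B cv u∈B v∈B Z q = Sum.[ (λ e → meets-at Z B _ e u∈B) , (λ e → meets-at Z B _ e v∈B) ] (cv Z q)
  noF : ∀ A → F ∋ A → lookup A x ≡ false → lookup A y ≡ false →
    ∀ w → lookup A w ≡ false → w ≢ x → w ≢ y → ∀ z → ¬ PairCover F w z
  noF A F∋A x∉A y∉A w w∉A w≢x w≢y z cv =
    let z∈A = Sum.[ (λ e → true≢false e w∉A) , (λ e → e) ] (cv A F∋A)
        B , ∣B∣ , xy∈B , wz∉B = through k (x ∷ y ∷ []) (w ∷ z ∷ [])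
          ((w≢x ∘ sym ∷ separate A z∈A x∉A ∘ sym ∷ []) ∷ (w≢y ∘ sym ∷ separate A z∈A y∉A ∘ sym ∷ []) ∷ [])
          (≤-trans (n≤1+n 2) 3≤k) (≤-trans (n≤1+n _) 3+k≤n)
        F∋B = closed B ∣B∣ (covers B cover (All.head xy∈B) (All.head (All.tail xy∈B)))
    in Sum.[ (λ e → true≢false e (All.head wz∉B)) , (λ e → true≢false e (All.head (All.tail wz∉B))) ] (cv B F∋B)
  noG : ∀ w → w ≢ x → w ≢ y → ∀ z → ¬ PairCover G w z
  noG w w≢x w≢y z cv with z ≟ᶠ y
  ... | yes refl =
    let B , ∣B∣ , wy∈B , x∉B = through k (w ∷ y ∷ []) (x ∷ []) ((w≢x ∷ []) ∷ (x≢y ∘ sym ∷ []) ∷ [])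
          (≤-trans (n≤1+n 2) 3≤k) (≤-trans (n≤1+n _) (≤-trans (n≤1+n _) 3+k≤n))
    in unsplit y x (λ Z q → Sum.swap (cover Z q))
         (B , closed B ∣B∣ (covers B cv (All.head wy∈B) (All.head (All.tail wy∈B))) ,
          All.head (All.tail wy∈B) , All.head x∉B)
  ... | no z≢y =
    let B , ∣B∣ , wzx∈B , y∉B = through k (w ∷ z ∷ x ∷ []) (y ∷ []) ((w≢y ∷ []) ∷ (z≢y ∷ []) ∷ (x≢y ∷ []) ∷ [])
          3≤k (≤-trans (n≤1+n _) (≤-trans (n≤1+n _) 3+k≤n))
    in unsplit x y cover
         (B , closed B ∣B∣ (covers B cv (All.head wzx∈B) (All.head (All.tail wzx∈B))) ,
          All.head (All.tail (All.tail wzx∈B)) , All.head y∉B)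

-- If G or F has a two-element transversal, `isolate` gives `w`; otherwise any element will do.
free-vertex : ∀ {n k} {F G : Fam (suc n)} → 3 ≤ k → k + k < suc n → Unif k F → Unif k G → NT F → NT G →
  Closed k F G → Closed k G F →
  (∀ x y → PairCover G x y → ¬ Splits F x y) → (∀ x y → PairCover F x y → ¬ Splits G x y) →
  ∃ λ w → NT (del w F) × NT (del w G)
free-vertex {F = F} {G} 3≤k le uF uG ntF ntG clF clG unF unG with somePairCover? G | somePairCover? F
... | inj₁ (x , y , p) | _ =
  let w , nF , nG = isolate 3≤k le uF ntF ntG clF unF x y p in w , del-NT w nF , del-NT w nG
... | inj₂ _ | inj₁ (x , y , p) =
  let w , nG , nF = isolate 3≤k le uG ntG ntF clG unG x y p in w , del-NT w nF , del-NT w nG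
... | inj₂ nG | inj₂ nF = zero , del-NT zero (nF zero) , del-NT zero (nG zero)

-- Estimates for F(w) and G(w) after shifting

bin≤cnt : ∀ {n} k {F : Fam n} → (∀ A → ∣ A ∣ ≡ k → F ∋ A) → bin n k ≤ cnt F
bin≤cnt {zero}  zero    full rewrite full [] refl = ≤-refl
bin≤cnt {zero}  (suc k) full = z≤n
bin≤cnt {suc n} zero    full = ≤-trans (bin≤cnt {n} zero λ A e → full (false ∷ A) e) (m≤n+m _ _)
bin≤cnt {suc n} (suc k) full =
  +-mono-≤ (bin≤cnt k λ A e → full (true ∷ A) (cong suc e)) (bin≤cnt (suc k) λ A e → full (false ∷ A) e)

-- relative-bound for the empty family and the family of all j-sets.
bin≤m : ∀ {n j k p} → suc j < k → j < p → k + suc j ≤ n → bin n j ≤ suc (m n j p k)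
bin≤m {n} {j} {k} {p} lt j<p le =
  let U , ∣U∣ , _ = through {n} j [] [] [] z≤n (≤-trans (n≤1+n j) (m+n≤o⇒n≤o k le))
  in ≤-trans (≤-trans (bin≤cnt j λ A e → level⁺ A e) (m≤n+m _ (cnt none)))
       (proj₁ (relative-bound j {F = none} {G = level} U (<⇒≤ lt) j<p le (λ _ ()) level⁻ (λ _ _ ()) (level⁺ U ∣U∣)
         (λ x _ → ⊥ , lookup-replicate x false , ≤-trans (≤-reflexive (∣⊥∣≡0 n)) z≤n , λ _ ()) (inj₁ lt)))
  where
  none level : Fam n
  none A = false
  level A = ⌊ ∣ A ∣ ≟ j ⌋
  level⁺ : ∀ A → ∣ A ∣ ≡ j → level ∋ A
  level⁺ A e with ∣ A ∣ ≟ j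
  ... | yes _ = refl
  ... | no ne = contradiction e ne
  level⁻ : Unif j level
  level⁻ A p with ∣ A ∣ ≟ j
  ... | yes e = e

NT? : ∀ {n} (F : Fam n) → NT F ⊎ ∃ λ x → ∀ A → F ∋ A → lookup A x ≡ true
NT? F with any? (λ x → ¬? (anySubset? (λ A → (F A ≟ᵇ true) ×-dec (lookup A x ≟ᵇ false))))
... | yes (x , ∄) = inj₂ (x , λ A p → ¬false→true λ e → ∄ (A , p , e))
... | no ∄ = inj₁ λ x → pick x
  where
  pick : ∀ x → ∃ λ A → F ∋ A × lookup A x ≡ false
  pick x with anySubset? (λ A → (F A ≟ᵇ true) ×-dec (lookup A x ≟ᵇ false))
  ... | yes p = p
  ... | no np = contradiction (x , np) ∄

module _ {s N : ℕ} where

  private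
    R K : ℕ
    R = suc (suc s)
    K = suc R

  -- Enlarging the first block from `R` to `K` elements gains at least three sets; they pay for the
  -- excess of two and for strictness.
  gain : K + K ≤ N → 3 + m N R K R ≤ m N K K R
  gain le = begin
    3 + m N R K R                            ≡⟨ +-comm 3 _ ⟩
    m N R K R + 3                            ≤⟨ +-monoʳ-≤ _ (h≥3 s (s≤s (s≤s (s≤s z≤n)))
                                                  (≤-trans (≤-reflexive (+-comm s 3)) (m+n≤o⇒m≤o∸n K le))) ⟩
    m N R K R + h (N ∸ K) K (suc s)          ≡⟨ sym (m-suc K (suc s) (m+n≤o⇒n≤o K le)) ⟩
    m N K K R ∎
    where open ≤-Reasoning

  -- Of three members of G, either two share `u`, and one of them meets the other without containing
  -- it, or two miss `u`. Both situations improve `cover-bound` by one.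
  cover-sharp : K + K ≤ N → {F G : Fam N} → Unif R F → Unif K G → Cross F G → NT G → 3 ≤ cnt G → suc (cnt F) ≤ m N K K R
  cover-sharp (s≤s (s≤s {n = M} le)) {F} {G} uF uG c ntG 3≤G =
    let U , G∋U = NT→NE ntG
        u , u∈U = element U (uG U G∋U)
    in go U G∋U u u∈U
    where
    hit : ∀ {V} → G ∋ V → Hits F V
    hit q A p = c A _ p q
    go : ∀ U → G ∋ U → ∀ u → lookup U u ≡ true → suc (cnt F) ≤ m (suc (suc M)) K K R
    go U G∋U u u∈U with 2 ≤? cnt (link u G)
    ... | yes 2≤ =
      let P , Q , P≢Q , G∋P , G∋Q = two-members (link u G) 2≤
          V = ins u true P
          W = ins u true Q
          v , v∈V , v∉W = difference V W (≤-reflexive (trans (uG W G∋Q) (sym (uG V G∋P)))) (P≢Q ∘ ins-injective u true)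
      in cover-bound-meeting V (uG V G∋P) le₁ uF (hit G∋P) (NT→avoid V ntG uG c) u v W
           (insertAt-lookup P u true) (insertAt-lookup Q u true) v∈V v∉W (≤-reflexive (uG W G∋Q)) (hit G∋Q)
      where
      le₁ : R + suc s ≤ M
      le₁ = ≤-trans (≤-reflexive (sym (+-suc (suc s) (suc s)))) (≤-trans (+-monoʳ-≤ (suc s) (n≤1+n (suc (suc s)))) le)
    ... | no 2≰ =
      let P , Q , P≢Q , G∋P , G∋Q = two-members (del u G) 2≤
      in cover-bound-two U (uG U G∋U) (m≤n⇒m≤1+n le) uF (hit G∋U) (NT→avoid U ntG uG c) u (ins u false P) (ins u false Q)
           u∈U (insertAt-lookup P u false) (insertAt-lookup Q u false) (P≢Q ∘ ins-injective u false)
           (uG _ G∋P) (uG _ G∋Q) (hit G∋P) (hit G∋Q)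
      where
      2≤ : 2 ≤ cnt (del u G)
      2≤ = +-cancelˡ-≤ 1 2 _ (≤-trans (≤-trans 3≤G (≤-reflexive (cnt-split u G))) (+-monoˡ-≤ _ (≤-pred (≰⇒> 2≰))))

-- For two stars with a common centre. By `h-pascal` both sides share the term `h M K (suc s)`; what
-- remains on the left is below C(M,s), which `bin≤m` compares with `m`, and one more element in the
-- first block gains three.
star-arithmetic : ∀ {s M} (let R = suc (suc s)) (let K = suc R) → K + K ≤ suc (suc M) →
  suc (h (suc M) K (suc s)) ≤ m (suc M) R K R
star-arithmetic {s} {M} (s≤s (s≤s le)) = begin
  suc (h (suc M) K (suc s))              ≡⟨ cong suc (h-pascal s K≤M) ⟩
  suc (h M K (suc s) + h M K s)          ≡⟨ sym (+-suc _ _) ⟩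
  h M K (suc s) + suc (h M K s)          ≤⟨ +-monoʳ-≤ (h M K (suc s)) tail ⟩
  h M K (suc s) + m M (suc s) K R ∎
  where
  open ≤-Reasoning
  R = suc (suc s)
  K = suc R
  K≤M : K ≤ M
  K≤M = m+n≤o⇒n≤o (suc s) le
  R+s≤M : R + suc (suc s) ≤ M
  R+s≤M = ≤-trans (≤-reflexive (sym (+-suc (suc s) (suc (suc s))))) le
  tail : suc (h M K s) ≤ m M (suc s) K R
  tail = begin
    suc (h M K s)                              ≤⟨ s≤s (h≤bin s K≤M) ⟩
    suc (bin M s)                              ≤⟨ s≤s (bin≤m ≤-refl (m≤n⇒m≤1+n (n≤1+n (suc s)))
                                                    (≤-trans (+-monoʳ-≤ R (n≤1+n (suc s))) R+s≤M)) ⟩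
    2 + m M s K R                              ≤⟨ n≤1+n _ ⟩
    3 + m M s K R                              ≡⟨ +-comm 3 _ ⟩
    m M s K R + 3                              ≤⟨ +-monoʳ-≤ _ (h≥3 s (s≤s (s≤s (s≤s z≤n)))
                                                    (m+n≤o⇒m≤o∸n (s + 3) (≤-trans (≤-reflexive (shuffle s)) R+s≤M))) ⟩
    m M s K R + h (M ∸ suc s) K (suc s)        ≡⟨ sym (m-suc K (suc s) (≤-trans (m≤n⇒m≤1+n (n≤1+n (suc s))) K≤M)) ⟩
    m M (suc s) K R ∎
    where
    shuffle : ∀ s → s + 3 + suc s ≡ suc (suc s) + suc (suc s)
    shuffle = solve-∀

-- The sets of `f` through the centre `x` of the star `g` hit a member of G₀ that misses `x`. If
-- other sets of `f` exist, `relative-bound` pairs them with g(x) and `gain` absorbs the excess. If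
-- not, `f` is a star as well, and g(x) is bounded in the same way through F₀.
top-star : ∀ {s M} (let R = suc (suc s)) (let K = suc R) → K + K ≤ suc M →
  {f g F₀ G₀ : Fam (suc M)} → Unif R f → Unif R g → Unif K F₀ → Unif K G₀ → NT F₀ → NT G₀ →
  Cross f g → Cross f G₀ → Cross F₀ g → NE g → ∀ x → (∀ A → g ∋ A → lookup A x ≡ true) →
  suc (cnt f + cnt g) ≤ m (suc M) K K R
top-star {s} {M} le {f} {g} {F₀} {G₀} uf ug uF uG ntF ntG cfg cfG cFg (X , g∋X) x star = go (NE? (del x f))
  where
  open ≤-Reasoning
  R = suc (suc s)
  K = suc R
  ¬dg : ¬ NE (del x g)
  ¬dg (B , q) = true≢false (star _ q) (insertAt-lookup B x false)
  link-bound : ∀ {e E} → Unif R e → Unif K E → NT E → Cross e E → cnt (link x e) ≤ h M K (suc s)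
  link-bound {e} {E} ue uE ntE c =
    avoid-link-bound x {⊥} ue (NT→avoid {F = e} (ins x true ⊥) ntE uE c)
  g-split : cnt g ≡ cnt (link x g)
  g-split = cnt-link x g ¬dg
  go : Dec (NE (del x f)) → suc (cnt f + cnt g) ≤ m (suc M) K K R
  go (yes neD) with NE-link {F = g} x X g∋X (star X g∋X)
  ... | X′ , q = begin
    suc (cnt f + cnt g)
      ≡⟨ cong suc (trans (cong₂ _+_ (cnt-split x f) g-split) (+-assoc (cnt (link x f)) _ _)) ⟩
    suc (cnt (link x f) + (cnt (del x f) + cnt (link x g)))
      ≤⟨ s≤s (+-mono-≤ (link-bound uf uG ntG cfG) (proj₁ (relative-bound (suc s) X′ ≤-refl (n≤1+n _) le′
           (unif-del x uf) (unif-link x ug) (cross-del-link x cfg) q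
           (avoid-del {F = f} x (NT→avoid (ins x true X′) ntG uG cfG)) (inj₂ neD)))) ⟩
    suc (h M K (suc s) + suc (m M (suc s) K R))
      ≡⟨ cong suc (+-suc _ _) ⟩
    2 + m (suc M) R K R
      ≤⟨ n≤1+n _ ⟩
    3 + m (suc M) R K R
      ≤⟨ gain le ⟩
    m (suc M) K K R ∎
    where
    le′ : R + suc (suc s) ≤ M
    le′ = ≤-trans (+-monoʳ-≤ R (n≤1+n _)) (≤-pred le)
  go (no ¬df) = begin
    suc (cnt f + cnt g)
      ≡⟨ cong suc (cong₂ _+_ (cnt-link x f ¬df) g-split) ⟩
    suc (cnt (link x f) + cnt (link x g))
      ≤⟨ s≤s (+-mono-≤ (link-bound uf uG ntG cfG) (link-bound ug uF ntF (Cross-sym cFg))) ⟩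
    suc (h M K (suc s) + h M K (suc s))
      ≡⟨ sym (+-suc _ _) ⟩
    h M K (suc s) + suc (h M K (suc s))
      ≤⟨ +-monoʳ-≤ (h M K (suc s)) (star-step le) ⟩
    h M K (suc s) + m M R K R ∎
    where
    star-step : ∀ {M} → K + K ≤ suc M → suc (h M K (suc s)) ≤ m M R K R
    star-step {zero} (s≤s ())
    star-step {suc M} = star-arithmetic

-- Here `f` and `g` are F(w) and G(w) made cross-intersecting. An empty one is handled by
-- `cover-sharp`, a trivial one by `top-star`, and two nontrivial ones by the induction hypothesis
-- together with `gain`.
top-bound : ∀ {s N} (let R = suc (suc s)) (let K = suc R) → K + K ≤ N →
  {f g F₀ G₀ : Fam N} → Unif R f → Unif R g → Unif K F₀ → Unif K G₀ → NT F₀ → NT G₀ →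
  Cross f g → Cross f G₀ → Cross F₀ g → (NT f → NT g → cnt f + cnt g ≤ 2 + m N R R R) →
  NE g ⊎ 3 ≤ cnt G₀ → NE f ⊎ 3 ≤ cnt F₀ → suc (cnt f + cnt g) ≤ m N K K R
top-bound {s} {suc M} le {f} {g} {F₀} {G₀} uf ug uF uG ntF ntG cfg cfG cFg IH g-or f-or = go (NE? f) (NE? g)
  where
  R = suc (suc s)
  K = suc R
  go : Dec (NE f) → Dec (NE g) → suc (cnt f + cnt g) ≤ m (suc M) K K R
  go _ (no ¬g) = subst (λ z → suc z ≤ m (suc M) K K R) (sym (trans (cong (cnt f +_) (cnt-empty ¬g)) (+-identityʳ _)))
    (cover-sharp le uf uG cfG ntG (Sum.[ (λ ne → contradiction ne ¬g) , (λ e → e) ] g-or))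
  go (no ¬f) (yes _) = subst (λ z → suc (z + cnt g) ≤ m (suc M) K K R) (sym (cnt-empty ¬f))
    (cover-sharp le ug uF (Cross-sym cFg) ntF (Sum.[ (λ ne → contradiction ne ¬f) , (λ e → e) ] f-or))
  go (yes nef) (yes neg) with NT? f | NT? g
  ... | inj₁ ntf | inj₁ ntg = ≤-trans (s≤s (≤-trans (IH ntf ntg) (+-monoʳ-≤ 2 (m-mono (suc M) R R (n≤1+n R))))) (gain le)
  ... | _ | inj₂ (x , star) = top-star le uf ug uF uG ntF ntG cfg cfG cFg neg x star
  ... | inj₂ (x , star) | inj₁ _ = subst (λ z → suc z ≤ m (suc M) K K R) (+-comm (cnt g) (cnt f))
    (top-star le ug uf uG uF ntG ntF (Cross-sym cfg) (Cross-sym cFg) (Cross-sym cfG) nef x star)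

-- Induction on the ground set for equal uniformities

cov-unif : ∀ {n k} (G : Fam n) → Unif k (cov k G)
cov-unif G A p = proj₁ (cov⁻ _ G A p)

cov-cross : ∀ {n k} (G : Fam n) → Cross (cov k G) G
cov-cross G A B p q = trans (meets-sym A B) (proj₂ (cov⁻ _ G A p) B q)

⊆cov : ∀ {n k} {F G : Fam n} → Unif k F → Cross F G → F ⊆ᶠ cov k G
⊆cov {G = G} uF c A p = cov⁺ _ G A (uF A p) λ B q → Cross-sym c B A q p

NT-mono : ∀ {n} {F F′ : Fam n} → F ⊆ᶠ F′ → NT F → NT F′
NT-mono sub nt x = let A , p , x∉ = nt x in A , sub A p , x∉

splitPair? : ∀ {n} (F G : Fam n) →
  (∃₂ λ x y → PairCover G x y × Splits F x y) ⊎ (∀ x y → PairCover G x y → ¬ Splits F x y)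
splitPair? F G with any? (λ x → any? (λ y → dec x y))
  where
  dec : ∀ x y → Dec (PairCover G x y × Splits F x y)
  dec x y with pairCover? G x y
  ... | inj₂ (A , p , x∉ , y∉) =
    no λ (cover , _) → Sum.[ (λ e → true≢false e x∉) , (λ e → true≢false e y∉) ] (cover A p)
  ... | inj₁ cover with anySubset? (λ A → (F A ≟ᵇ true) ×-dec ((lookup A x ≟ᵇ true) ×-dec (lookup A y ≟ᵇ false)))
  ... | yes sp = yes (cover , sp)
  ... | no ¬sp = no (¬sp ∘ proj₂)
... | yes (x , y , p) = inj₁ (x , y , p)
... | no ∄ = inj₂ λ x y cover sp → ∄ (x , y , cover , sp)

sharp-pair′ : ∀ {N s} (let K = suc (suc (suc s))) {F G : Fam (suc N)} → K + K ≤ N →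
  Unif K F → Unif K G → Cross F G → NT F → NT G → 3 ≤ cnt G → Closed K F G →
  ∀ x y → PairCover G x y → Splits F x y → cnt F + cnt G ≤ 1 + m (suc N) K K K
sharp-pair′ {suc M} le uF uG c ntF ntG = sharp-pair le uF uG c ntF ntG (s≤s (s≤s (s≤s z≤n)))

EqualBound : ℕ → Set
EqualBound n = ∀ {k} → 2 ≤ k → k + k < n → {F G : Fam n} → Unif k F → Unif k G → Cross F G → NT F → NT G →
  cnt F + cnt G ≤ 2 + m n k k k

-- Among the halves of a 2K-set, only two complementary halves themselves fail to meet both of them.
bin-double : ∀ k → bin (suc k + suc k) (suc k) ≡ 2 + m (suc k + suc k) (suc k) (suc k) (suc k)
bin-double k = begin
  bin n K                                                ≡⟨ sym (+-identityʳ _) ⟩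
  bin n K + bin 0 K
    ≡⟨ cong (λ z → bin n K + bin z K) (sym (trans (cong (_∸ K) (m+n∸m≡n K K)) (n∸n≡0 K))) ⟩
  bin n K + bin (n ∸ K ∸ K) K                            ≡⟨ sym (m+bin {n} {K} {K} K ≤-refl) ⟩
  m n K K K + (bin (n ∸ K) K + bin (n ∸ K) K)
    ≡⟨ cong (λ z → m n K K K + (z + z)) (trans (cong (λ z → bin z K) (m+n∸m≡n K K)) (bin-full K)) ⟩
  m n K K K + 2                                          ≡⟨ +-comm _ 2 ⟩
  2 + m n K K K ∎
  where
  open ≡-Reasoning
  K = suc k
  n = K + K

module _ {N s} (IH : EqualBound N) (le : suc (suc (suc s)) + suc (suc (suc s)) ≤ N)
  {F G : Fam (suc N)} (uF : Unif (suc (suc (suc s))) F) (uG : Unif (suc (suc (suc s))) G)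
  (c : Cross F G) (3≤F : 3 ≤ cnt F) (3≤G : 3 ≤ cnt G) where

  private
    R K : ℕ
    R = suc (suc s)
    K = suc R

  -- By `m-pascal` the target splits into a part for the links and a part for the deletions. The
  -- deletions may exceed theirs by two, but the links stay strictly below theirs.
  sharp-layers : ∀ w → NT (del w F) → NT (del w G) → cnt F + cnt G ≤ 1 + m (suc N) K K K
  sharp-layers w ntF₀ ntG₀ = ≤-pred (begin
    suc (cnt F + cnt G)
      ≡⟨ cong suc (cnt-layer-split w F G) ⟩
    suc ((cnt (link w F) + cnt (link w G)) + (cnt (del w F) + cnt (del w G)))
      ≡⟨ cong suc (sym (total-stabilised S)) ⟩
    suc (cnt L.F₁ + cnt L.G₁) + (cnt L.F₀ + cnt L.G₀)
      ≤⟨ +-mono-≤ top (bottom (m≤n⇒m<n∨m≡n le)) ⟩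
    m N K K R + (2 + m N K K K)
      ≡⟨ shuffle (m N K K R) _ ⟩
    2 + (m N K K K + m N K K R)
      ≡⟨ cong (2 +_) (sym (m-pascal K R le)) ⟩
    2 + m (suc N) K K K ∎)
    where
    open ≤-Reasoning
    shuffle : ∀ a b → a + (2 + b) ≡ 2 + (b + a)
    shuffle = solve-∀
    R+R<N : R + R < N
    R+R<N = ≤-trans (s≤s (+-monoʳ-≤ R (n≤1+n R))) le
    S = stabilise (layers w uF uG c) R+R<N
    open Stabilised S renaming (module R to L)
    ntF = NT-mono F₀⊆ ntF₀
    ntG = NT-mono G₀⊆ ntG₀
    -- If shifting has emptied the link, all members are now in the deletion, which therefore has at
    -- least three.
    top-or : ∀ {E E₁ E₀} → 3 ≤ cnt E → cnt E₁ + cnt E₀ ≡ cnt (link w E) + cnt (del w E) → NE {N} E₁ ⊎ 3 ≤ cnt {N} E₀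
    top-or {E} {E₁} {E₀} 3≤E e with NE? E₁
    ... | yes ne = inj₁ ne
    ... | no ¬ne = inj₂ (≤-trans 3≤E (≤-reflexive (trans (cnt-split w E)
      (trans (sym e) (cong (_+ cnt E₀) (cnt-empty ¬ne))))))
    top : suc (cnt L.F₁ + cnt L.G₁) ≤ m N K K R
    top = top-bound le L.unifF₁ L.unifG₁ L.unifF₀ L.unifG₀ ntF ntG cross₁₁ L.cross₁₀ L.cross₀₁
      (IH (s≤s (s≤s z≤n)) R+R<N L.unifF₁ L.unifG₁ cross₁₁) (top-or {G} 3≤G cntG) (top-or {F} 3≤F cntF)
    bottom : K + K < N ⊎ K + K ≡ N → cnt L.F₀ + cnt L.G₀ ≤ 2 + m N K K K
    bottom (inj₁ lt)   = IH (s≤s (s≤s z≤n)) lt L.unifF₀ L.unifG₀ L.cross₀₀ ntF ntG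
    bottom (inj₂ refl) = ≤-trans (cross-bound N ≤-refl le L.unifF₀ L.unifG₀ L.cross₀₀) (≤-reflexive (bin-double R))

  -- A two-element transversal split by the opposite family gives a pivot; without one,
  -- `free-vertex` supplies the element `w` to shift from.
  sharp-closed : NT F → NT G → Closed K F G → Closed K G F → cnt F + cnt G ≤ 1 + m (suc N) K K K
  sharp-closed ntF ntG clF clG with splitPair? F G | splitPair? G F
  ... | inj₁ (x , y , cover , sp) | _ = sharp-pair′ le uF uG c ntF ntG 3≤G clF x y cover sp
  ... | inj₂ _ | inj₁ (x , y , cover , sp) =
    subst (_≤ 1 + m (suc N) K K K) (+-comm (cnt G) (cnt F))
      (sharp-pair′ le uG uF (Cross-sym c) ntG ntF 3≤F clG x y cover sp)
  ... | inj₂ unF | inj₂ unG =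
    let w , ntF₀ , ntG₀ = free-vertex (s≤s (s≤s (s≤s z≤n))) (s≤s le) uF uG ntF ntG clF clG unF unG
    in sharp-layers w ntF₀ ntG₀

-- F is enlarged to all k-sets hitting G, then G to all k-sets hitting the new F. As G only grows,
-- the new F remains closed.
sharp-equal : ∀ {N k} → EqualBound N → 3 ≤ k → k + k ≤ N → {F G : Fam (suc N)} → Unif k F → Unif k G → Cross F G →
  NT F → NT G → 3 ≤ cnt F → 3 ≤ cnt G → cnt F + cnt G ≤ 1 + m (suc N) k k k
sharp-equal {N} {k} IH (s≤s (s≤s (s≤s _))) le {F} {G} uF uG c ntF ntG 3≤F 3≤G =
  ≤-trans (+-mono-≤ (cnt-mono F⊆) (cnt-mono G⊆))
    (sharp-closed IH le (cov-unif G) (cov-unif F⁺) (Cross-sym (cov-cross F⁺))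
      (≤-trans 3≤F (cnt-mono F⊆)) (≤-trans 3≤G (cnt-mono G⊆)) (NT-mono F⊆ ntF) (NT-mono G⊆ ntG)
      (λ A e hit → cov⁺ k G A e λ B q → hit B (G⊆ B q)) (cov⁺ k F⁺))
  where
  F⁺ = cov k G
  G⁺ = cov k F⁺
  F⊆ : F ⊆ᶠ F⁺
  F⊆ = ⊆cov uF c
  G⊆ : G ⊆ᶠ G⁺
  G⊆ = ⊆cov uG (Cross-sym (cov-cross G))

equal-bound : ∀ n → EqualBound n
equal-bound (suc N) {k} 2≤k (s≤s le) {F} {G} uF uG c ntF ntG with cnt G ≤? 2 | cnt F ≤? 2
... | yes G≤2 | _ = few-bound uF uG c ntG G≤2
... | no _ | yes F≤2 =
  subst (_≤ 2 + m (suc N) k k k) (+-comm (cnt G) (cnt F)) (few-bound uG uF (Cross-sym c) ntF F≤2)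
... | no G≰2 | no F≰2 with m≤n⇒m<n∨m≡n 2≤k
... | inj₁ 3≤k = ≤-trans (sharp-equal (equal-bound N) 3≤k le uF uG c ntF ntG (≰⇒> F≰2) (≰⇒> G≰2)) (n≤1+n _)
-- For k = 2, three edges in F provide the pivot directly.
equal-bound (suc (suc M)) {k} 2≤k (s≤s le) {F} {G} uF uG c ntF ntG | no _ | no F≰2 | inj₂ refl =
  let x , y , cover , sp = graph-pair uF uG c (NT→NE ntG) (≰⇒> F≰2)
  in proj₁ (pair-pivot le uF uG c ntF ntG x y cover sp)

unequal-sharp : ∀ {n k ℓ} → 2 ≤ ℓ → ℓ < k → k + ℓ < n → {F G : Fam n} → Unif k F → Unif ℓ G → Cross F G →
  NT F → NT G → 3 ≤ cnt G → cnt F + cnt G ≤ 1 + m n ℓ ℓ k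
unequal-sharp {suc N} {suc k} {suc (suc l)} _ (s≤s l<k) (s≤s le) {F} {G} uF uG c ntF ntG 3≤G =
  ≤-trans (+-monoˡ-≤ (cnt G) (cnt-mono F⊆))
    (sharp-unequal l<k le (cov-unif G) uG (cov-cross G) ntG (NT→NE (NT-mono F⊆ ntF)) (cov⁺ (suc k) G) 3≤G)
  where
  F⊆ : F ⊆ᶠ cov (suc k) G
  F⊆ = ⊆cov uF c
unequal-sharp {suc N} {suc k} {suc zero} (s≤s ())

-- The bound and its strict form for all uniformities

bound : ∀ {n k ℓ} → 2 ≤ ℓ → ℓ ≤ k → k + ℓ < n → {F G : Fam n} → Unif k F → Unif ℓ G → Cross F G →
  NT F → NT G → cnt F + cnt G ≤ 2 + m n ℓ ℓ k
bound {suc N} 2≤ℓ ℓ≤k lt {F} {G} uF uG c ntF ntG with m≤n⇒m<n∨m≡n ℓ≤k | cnt G ≤? 2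
... | inj₂ refl | _ = equal-bound (suc N) 2≤ℓ lt uF uG c ntF ntG
... | inj₁ ℓ<k | yes G≤2 = few-bound uF uG c ntG G≤2
... | inj₁ ℓ<k | no G≰2 = ≤-trans (unequal-sharp 2≤ℓ ℓ<k lt uF uG c ntF ntG (≰⇒> G≰2)) (n≤1+n _)

sharp : ∀ {n k ℓ} → 2 ≤ ℓ → ℓ ≤ k → k + ℓ < n → ¬ (k ≡ 2 × ℓ ≡ 2) → {F G : Fam n} → Unif k F → Unif ℓ G → Cross F G →
  NT F → NT G → 3 ≤ cnt G → (k ≡ ℓ → 3 ≤ cnt F) → cnt F + cnt G ≤ 1 + m n ℓ ℓ k
sharp {suc N} 2≤ℓ ℓ≤k (s≤s le) ≢2 uF uG c ntF ntG 3≤G 3≤F with m≤n⇒m<n∨m≡n ℓ≤k | m≤n⇒m<n∨m≡n 2≤ℓ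
... | inj₁ ℓ<k | _ = unequal-sharp 2≤ℓ ℓ<k (s≤s le) uF uG c ntF ntG 3≤G
... | inj₂ refl | inj₁ 3≤ℓ = sharp-equal (equal-bound N) 3≤ℓ le uF uG c ntF ntG (3≤F refl) 3≤G
... | inj₂ refl | inj₂ refl = contradiction (refl , refl) ≢2

-- Families as lists

module _ {n : ℕ} where
  open DecMembership (_≟ˢ_ {n}) public using (_∈?_)

⟦_⟧ : ∀ {n} → Family n → Fam n
⟦ 𝓕 ⟧ A = ⌊ A ∈? 𝓕 ⌋

⟦⟧⁺ : ∀ {n} (𝓕 : Family n) {A} → A ∈F 𝓕 → ⟦ 𝓕 ⟧ ∋ A
⟦⟧⁺ 𝓕 {A} A∈ with A ∈? 𝓕
... | yes _ = refl
... | no A∉ = contradiction A∈ A∉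

⟦⟧⁻ : ∀ {n} (𝓕 : Family n) {A} → ⟦ 𝓕 ⟧ ∋ A → A ∈F 𝓕
⟦⟧⁻ 𝓕 {A} p with A ∈? 𝓕
... | yes A∈ = A∈

-- Each list entry is removed from `P` in turn; by uniqueness the later entries remain.
length≤cnt : ∀ {n} (𝓕 : Family n) {P : Fam n} → Unique 𝓕 → (∀ {A} → A ∈F 𝓕 → P ∋ A) → length 𝓕 ≤ cnt P
length≤cnt []      _          _   = z≤n
length≤cnt (A ∷ 𝓕) {P} (A∉ ∷ u) sub = ≤-trans
  (s≤s (length≤cnt 𝓕 u λ B∈ → without⁺ P (sub (there B∈)) (All.lookup A∉ B∈ ∘ sym)))
  (cnt-without P (sub (here refl)))

⟦⟧-unif : ∀ {n k} (𝓕 : Family n) → IsKFamily k 𝓕 → Unif k ⟦ 𝓕 ⟧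
⟦⟧-unif 𝓕 (_ , size) A p = All.lookup size (⟦⟧⁻ 𝓕 p)

⟦⟧-NT : ∀ {n} (𝓕 : Family n) → NonTrivial 𝓕 → NT ⟦ 𝓕 ⟧
⟦⟧-NT 𝓕 nt x = let A , A∈ , x∉ = nt x in A , ⟦⟧⁺ 𝓕 A∈ , ¬true→false (x∉ ∘ lookup⇒[]= x A)

Nonempty→meets : ∀ {n} (A B : Subset n) → Nonempty (A ∩ B) → meets A B ≡ true
Nonempty→meets A B (x , x∈) = let x∈A , x∈B = x∈p∩q⁻ A B x∈ in meets-at A B x ([]=⇒lookup x∈A) ([]=⇒lookup x∈B)

⟦⟧-cross : ∀ {n} (𝓕 𝓖 : Family n) → CrossIntersecting 𝓕 𝓖 → Cross ⟦ 𝓕 ⟧ ⟦ 𝓖 ⟧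
⟦⟧-cross 𝓕 𝓖 c A B p q = Nonempty→meets A B (c (⟦⟧⁻ 𝓕 p) (⟦⟧⁻ 𝓖 q))

⟦⟧-length : ∀ {n k} (𝓕 : Family n) → IsKFamily k 𝓕 → length 𝓕 ≤ cnt ⟦ 𝓕 ⟧
⟦⟧-length 𝓕 (u , _) = length≤cnt 𝓕 u (⟦⟧⁺ 𝓕)

-- The identity `m+bin` for two blocks of size ℓ, written without subtraction of counts.
m-formula : ∀ {n k ℓ} → ℓ + ℓ ≤ n → m n ℓ ℓ k + 2 * ((n ∸ ℓ) C k) ≡ n C k + (n ∸ 2 * ℓ) C k
m-formula {n} {k} {ℓ} le = begin
  m n ℓ ℓ k + 2 * ((n ∸ ℓ) C k)
    ≡⟨ cong (λ z → m n ℓ ℓ k + ((n ∸ ℓ) C k + z)) (+-identityʳ _) ⟩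
  m n ℓ ℓ k + ((n ∸ ℓ) C k + (n ∸ ℓ) C k)
    ≡⟨ cong (λ z → m n ℓ ℓ k + (z + z)) (sym (bin≡C (n ∸ ℓ) k)) ⟩
  m n ℓ ℓ k + (bin (n ∸ ℓ) k + bin (n ∸ ℓ) k)
    ≡⟨ m+bin {n} {ℓ} {ℓ} k le ⟩
  bin n k + bin (n ∸ ℓ ∸ ℓ) k
    ≡⟨ cong (λ z → bin n k + bin z k) (trans (∸-+-assoc n ℓ ℓ) (cong (λ z → n ∸ (ℓ + z)) (sym (+-identityʳ ℓ)))) ⟩
  bin n k + bin (n ∸ 2 * ℓ) k
    ≡⟨ cong₂ _+_ (bin≡C n k) (bin≡C (n ∸ 2 * ℓ) k) ⟩
  n C k + (n ∸ 2 * ℓ) C k ∎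
  where open ≡-Reasoning

-- The excess `t` over `m` is two for the bound and one for the strict inequality.
from-m : ∀ {n k ℓ} t X → ℓ + ℓ ≤ n → X ≤ t + m n ℓ ℓ k →
  X + 2 * ((n ∸ ℓ) C k) ≤ n C k + (n ∸ 2 * ℓ) C k + t
from-m {n} {k} {ℓ} t X le X≤ = begin
  X + 2 * ((n ∸ ℓ) C k)                      ≤⟨ +-monoˡ-≤ _ X≤ ⟩
  t + m n ℓ ℓ k + 2 * ((n ∸ ℓ) C k)          ≡⟨ +-assoc t _ _ ⟩
  t + (m n ℓ ℓ k + 2 * ((n ∸ ℓ) C k))        ≡⟨ cong (t +_) (m-formula {n} {k} {ℓ} le) ⟩
  t + (n C k + (n ∸ 2 * ℓ) C k)              ≡⟨ +-comm t _ ⟩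
  n C k + (n ∸ 2 * ℓ) C k + t ∎
  where open ≤-Reasoning

module _ {n k ℓ} (2≤ℓ : 2 ≤ ℓ) (ℓ≤k : ℓ ≤ k) (lt : k + ℓ < n) where

  private
    ℓ+ℓ≤n : ℓ + ℓ ≤ n
    ℓ+ℓ≤n = ≤-trans (+-monoˡ-≤ ℓ ℓ≤k) (<⇒≤ lt)

  family-bound : (𝓕 𝓖 : Family n) → IsKFamily k 𝓕 → IsKFamily ℓ 𝓖 → NonTrivial 𝓕 → NonTrivial 𝓖 → CrossIntersecting 𝓕 𝓖 →
    length 𝓕 + length 𝓖 + 2 * ((n ∸ ℓ) C k) ≤ n C k + (n ∸ 2 * ℓ) C k + 2
  family-bound 𝓕 𝓖 kF kG ntF ntG c = from-m {n} {k} {ℓ} 2 _ ℓ+ℓ≤n (≤-trans (+-mono-≤ (⟦⟧-length 𝓕 kF) (⟦⟧-length 𝓖 kG))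
    (bound 2≤ℓ ℓ≤k lt (⟦⟧-unif 𝓕 kF) (⟦⟧-unif 𝓖 kG) (⟦⟧-cross 𝓕 𝓖 c) (⟦⟧-NT 𝓕 ntF) (⟦⟧-NT 𝓖 ntG)))

  family-sharp : ¬ (k ≡ 2 × ℓ ≡ 2) →
    (𝓕 𝓖 : Family n) → IsKFamily k 𝓕 → IsKFamily ℓ 𝓖 → NonTrivial 𝓕 → NonTrivial 𝓖 → CrossIntersecting 𝓕 𝓖 →
    3 ≤ length 𝓖 → (k ≡ ℓ → 3 ≤ length 𝓕) →
    length 𝓕 + length 𝓖 + 2 * ((n ∸ ℓ) C k) < n C k + (n ∸ 2 * ℓ) C k + 2
  family-sharp ≢2 𝓕 𝓖 kF kG ntF ntG c 3≤G 3≤F =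
    ≤-trans (s≤s (from-m {n} {k} {ℓ} 1 _ ℓ+ℓ≤n (≤-trans (+-mono-≤ (⟦⟧-length 𝓕 kF) (⟦⟧-length 𝓖 kG))
      (sharp 2≤ℓ ℓ≤k lt ≢2 (⟦⟧-unif 𝓕 kF) (⟦⟧-unif 𝓖 kG) (⟦⟧-cross 𝓕 𝓖 c) (⟦⟧-NT 𝓕 ntF) (⟦⟧-NT 𝓖 ntG)
        (≤-trans 3≤G (⟦⟧-length 𝓖 kG)) (λ e → ≤-trans (3≤F e) (⟦⟧-length 𝓕 kF))))))
      (≤-reflexive (sym (+-suc _ 1)))

  -- A missing set A of the extremal 𝓕 could be added to 𝓕, against the bound.
  two-extremal : (𝓕 𝓖 : Family n) → IsKFamily k 𝓕 → IsKFamily ℓ 𝓖 → NonTrivial 𝓕 → NonTrivial 𝓖 → CrossIntersecting 𝓕 𝓖 →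
    length 𝓖 ≤ 2 → length 𝓕 + length 𝓖 + 2 * ((n ∸ ℓ) C k) ≡ n C k + (n ∸ 2 * ℓ) C k + 2 → Extremal k ℓ 𝓕 𝓖
  two-extremal 𝓕 [] _ _ _ ntG _ _ _ with ntG (fromℕ< lt)
  ... | _ , () , _
  -- A single nonempty member would have an element common to the whole family.
  two-extremal 𝓕 (U ∷ []) _ (_ , ∣U∣ ∷ []) _ ntG _ _ _
    with element U (trans ∣U∣ (sym (m+[n∸m]≡n (<⇒≤ 2≤ℓ))))
  ... | x , x∈U with ntG x
  ... | _ , here refl , x∉U = contradiction (lookup⇒[]= x U x∈U) x∉U
  two-extremal 𝓕 (U ∷ V ∷ []) kF@(uniqF , sizeF) kG@(_ , ∣U∣ ∷ ∣V∣ ∷ []) ntF ntG c _ eq =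
    U , V , ∣U∣ , ∣V∣ , disjoint ,
    (λ A → mk⇔ (λ { (here e) → inj₁ e ; (there (here e)) → inj₂ e }) (λ { (inj₁ e) → here e ; (inj₂ e) → there (here e) })) ,
    (λ A → mk⇔ (λ A∈ → All.lookup sizeF A∈ , c A∈ (here refl) , c A∈ (there (here refl))) (member A))
    where
    disjoint : Empty (U ∩ V)
    disjoint (x , x∈) with x∈p∩q⁻ U V x∈ | ntG x
    ... | x∈U , _ | _ , here refl , x∉U = x∉U x∈U
    ... | _ , x∈V | _ , there (here refl) , x∉V = x∉V x∈V
    member : ∀ A → ∣ A ∣ ≡ k × Nonempty (A ∩ U) × Nonempty (A ∩ V) → A ∈F 𝓕
    member A (∣A∣ , A∩U , A∩V) with A ∈? 𝓕
    ... | yes A∈ = A∈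
    ... | no A∉ = contradiction
      (family-bound (A ∷ 𝓕) (U ∷ V ∷ []) (¬Any⇒All¬ 𝓕 A∉ ∷ uniqF , ∣A∣ ∷ sizeF) kG
        (λ x → let B , B∈ , x∉ = ntF x in B , there B∈ , x∉) ntG cross)
      (<⇒≱ (≤-reflexive (cong suc (sym eq))))
      where
      cross : CrossIntersecting (A ∷ 𝓕) (U ∷ V ∷ [])
      cross (here refl) (here refl)         = A∩U
      cross (here refl) (there (here refl)) = A∩V
      cross (there B∈)  C∈                  = c B∈ C∈
  two-extremal 𝓕 (_ ∷ _ ∷ _ ∷ _) _ _ _ _ _ (s≤s (s≤s ())) _

theorem4p1 : (n k ℓ : ℕ) → 2 ≤ ℓ → ℓ ≤ k → k + ℓ < n →
    (𝓕 𝓖 : Family n) → IsKFamily k 𝓕 → IsKFamily ℓ 𝓖 →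
    NonTrivial 𝓕 → NonTrivial 𝓖 → CrossIntersecting 𝓕 𝓖 →
    (length 𝓕 + length 𝓖 + 2 * ((n ∸ ℓ) C k) ≤ n C k + (n ∸ 2 * ℓ) C k + 2)
    × (¬ (k ≡ 2 × ℓ ≡ 2) →
    length 𝓕 + length 𝓖 + 2 * ((n ∸ ℓ) C k) ≡ n C k + (n ∸ 2 * ℓ) C k + 2 →
    Extremal k ℓ 𝓕 𝓖 ⊎ (k ≡ ℓ × Extremal ℓ k 𝓖 𝓕))
theorem4p1 n k ℓ 2≤ℓ ℓ≤k lt 𝓕 𝓖 kF kG ntF ntG c = family-bound 2≤ℓ ℓ≤k lt 𝓕 𝓖 kF kG ntF ntG c , extremal
  where
  extremal : ¬ (k ≡ 2 × ℓ ≡ 2) →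
    length 𝓕 + length 𝓖 + 2 * ((n ∸ ℓ) C k) ≡ n C k + (n ∸ 2 * ℓ) C k + 2 →
    Extremal k ℓ 𝓕 𝓖 ⊎ (k ≡ ℓ × Extremal ℓ k 𝓖 𝓕)
  extremal ≢2 eq with length 𝓖 ≤? 2 | (k ≟ ℓ) ×-dec (length 𝓕 ≤? 2)
  ... | yes G≤2 | _ = inj₁ (two-extremal 2≤ℓ ℓ≤k lt 𝓕 𝓖 kF kG ntF ntG c G≤2 eq)
  ... | no _ | yes (refl , F≤2) = inj₂ (refl , two-extremal 2≤ℓ ℓ≤k lt 𝓖 𝓕 kG kF ntG ntF
    (λ {A} {B} A∈ B∈ → subst Nonempty (∩-comm B A) (c B∈ A∈)) F≤2
    (trans (cong (_+ 2 * ((n ∸ ℓ) C k)) (+-comm (length 𝓖) (length 𝓕))) eq))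
  ... | no G≰2 | no F≰2 = contradiction eq
    (<⇒≢ (family-sharp 2≤ℓ ℓ≤k lt ≢2 𝓕 𝓖 kF kG ntF ntG c (≰⇒> G≰2) (λ e → ≰⇒> λ F≤2 → F≰2 (e , F≤2))))
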